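{- Let $k\ge 1$, let $\mathcal{G}_1,\ldots,\mathcal{G}_k$ be ordered graphs, each containing at least one edge, let $\boldsymbol{\lambda}=(\lambda_1,\ldots,\lambda_k)\in(0,\infty)^k$, and put $h_i=v(\mathcal{G}_i)$, $e_i=e(\mathcal{G}_i)$, $h_*=\min_{i\in[k]}h_i$ and $I_*=\{i\in[k]:h_i=h_*\}$. For every $n$, $$\overline{\mathrm{M}}_{\boldsymbol{\lambda}}(n;\mathcal{G}_1,\ldots,\mathcal{G}_k)\ \le\ \min_{\substack{p_1,\ldots,p_k\ge0\\ \sum_{i=1}^k p_i=1}}\ \sum_{i=1}^{k}\lambda_i p_i^{e_i}\binom{n}{h_i}.$$ Thus $$\pi_{\boldsymbol{\lambda}}(\mathcal{G}_1,\ldots,\mathcal{G}_k)\ \le\ \min_{\substack{p_i\ge0\ (i\in I_*)\\ \sum_{i\in I_*}p_i=1}}\ \sum_{i\in I_*}\lambda_i p_i^{e_i}.\qquad(\ast)$$ In particular, if there is $e>1$ with $e_i=e$ for every $i\in I_*$, then $$\pi_{\boldsymbol{\lambda}}(\mathcal{G}_1,\ldots,\mathcal{G}_k)\ \le\ \left(\sum_{i\in I_*}\lambda_i^{ -1/(e-1)}\right)^{1-e},$$ and if $e_i=1$ for every $i\in I_*$, then the right-hand side of $(\ast)$ equals $\min_{i\in I_*}\lambda_i$.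
   Context: An ordered graph is a pair $\mathcal{G}=(G,<_{\mathcal{G}})$ where $G$ is a finite graph and $<_{\mathcal{G}}$ is a linear order on $V(G)$; $v(\mathcal{G})$ and $e(\mathcal{G})$ are its numbers of vertices and edges. $[k]=\{1,\ldots,k\}$. $\mathcal{K}_n$ is the complete graph on $[n]$ with the natural order. An order-preserving copy of an ordered graph $\mathcal{H}$ in $\mathcal{G}$ is an injective map $V(\mathcal{H})\to V(\mathcal{G})$ that preserves the vertex order and maps every edge of $\mathcal{H}$ to an edge of $\mathcal{G}$; copies are counted by their vertex sets (an $h$-element vertex set supports at most one copy of a fixed $h$-vertex ordered graph). For a coloring $\chi:E(\mathcal{K}_n)\to[k]$, $N_i(\chi;\mathcal{G}_i)$ is the number of order-preserving copies of $\mathcal{G}_i$ in $\mathcal{K}_n$ all of whose edges have color $i$. The weighted ordered multiplicity function is $$\overline{\mathrm{M}}_{\boldsymbol{\lambda}}(n;\mathcal{G}_1,\ldots,\mathcal{G}_k)=\min_{\chi:E(\mathcal{K}_n)\to[k]}\sum_{i=1}^{k}\lambda_iN_i(\chi;\mathcal{G}_i),$$ and $$\pi_{\boldsymbol{\lambda}}(\mathcal{G}_1,\ldots,\mathcal{G}_k)=\lim_{n\to\infty}\frac{\overline{\mathrm{M}}_{\boldsymbol{\lambda}}(n;\mathcal{G}_1,\ldots,\mathcal{G}_k)}{\binom{n}{h_*}},$$ a limit which exists. Convention: $\binom{x}{q}=0$ when $q<0$ or $q>x$. -}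

module Defs where

open import Algebra.Bundles using (CommutativeRing; Semiring)
open import Algebra.Structures using (IsCommutativeRing)
import Algebra.Definitions.RawSemiring as RawSemiringDefinitions
open import Data.Bool.Base using (if_then_else_)
open import Data.Fin.Base as Fin using (Fin; zero; combine; finToFun)
import Data.Fin.Properties as Fin
open import Data.List.Base using (List; allFin; cartesianProduct; filter; length; map)
import Data.List.Extrema
import Data.List.Extrema.Nat as ℕ-Extrema
open import Data.Nat.Base as ℕ using (ℕ; suc)
import Data.Nat.Properties as ℕ
open import Data.Nat.Combinatorics using (_C_)
open import Data.Product.Base using (∃; _×_; _,_)
open import Level using (Level; _⊔_; 0ℓ) renaming (suc to lsuc)
open import Relation.Binary.Bundles using (DecTotalOrder)
open import Relation.Binary.Core using (Rel)
import Relation.Binary.Construct.NonStrictToStrict as NonStrictToStrict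
import Relation.Binary.Definitions as B
open import Relation.Binary.PropositionalEquality.Core using (_≡_)
open import Relation.Binary.Structures using (IsDecTotalOrder)
open import Relation.Nullary.Decidable.Core using (does; _×-dec_; _→-dec_)
open import Relation.Nullary.Negation.Core using (¬_)
open import Relation.Unary using (Pred; Decidable)

private
  variable
    a s : Level
    k n : ℕ

------------------------------------------------------------------------
-- The real numbers

-- The field ℝ is characterised, up to unique isomorphism, as a
-- Dedekind-complete totally ordered field, and is used only through this
-- characterisation. The order is decidable, as it is classically. The
-- value of the inverse at 0# is left unspecified.

record CompleteOrderedField c ℓ₁ ℓ₂ : Set (lsuc (c ⊔ ℓ₁ ⊔ ℓ₂)) where
  infix  8 _⁻¹
  infix  8 -_
  infixl 7 _*_
  infixl 6 _+_
  infix  4 _≈_ _≤_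
  field
    Carrier           : Set c
    _≈_               : Rel Carrier ℓ₁
    _≤_               : Rel Carrier ℓ₂
    _+_ _*_           : Carrier → Carrier → Carrier
    -_ _⁻¹            : Carrier → Carrier
    0# 1#             : Carrier
    isCommutativeRing : IsCommutativeRing _≈_ _+_ _*_ -_ 0# 1#
    isDecTotalOrder   : IsDecTotalOrder _≈_ _≤_
    0≉1               : ¬ 0# ≈ 1#
    *-inverseʳ        : ∀ x → ¬ x ≈ 0# → x * x ⁻¹ ≈ 1#
    +-monoˡ-≤         : ∀ z {x y} → x ≤ y → x + z ≤ y + z
    *-nonNeg          : ∀ {x y} → 0# ≤ x → 0# ≤ y → 0# ≤ x * y

  UpperBound : ∀ {p} → Pred Carrier p → Pred Carrier (c ⊔ ℓ₂ ⊔ p)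
  UpperBound P b = ∀ x → P x → x ≤ b

  field
    supremum : (P : Pred Carrier (c ⊔ ℓ₁ ⊔ ℓ₂)) → ∃ P → ∃ (UpperBound P) →
               ∃ λ s → UpperBound P s × (∀ b → UpperBound P b → s ≤ b)

  commutativeRing : CommutativeRing c ℓ₁
  commutativeRing = record { isCommutativeRing = isCommutativeRing }

  decTotalOrder : DecTotalOrder c ℓ₁ ℓ₂
  decTotalOrder = record { isDecTotalOrder = isDecTotalOrder }

  open CommutativeRing commutativeRing public using (_-_; semiring)
  open Semiring semiring public using (rawSemiring)
  open DecTotalOrder decTotalOrder public using (totalOrder)
  open NonStrictToStrict _≈_ _≤_ public using (_<_)
  open RawSemiringDefinitions rawSemiring public using (sum; _^_) renaming (_×_ to _·_)

  fromℕ : ℕ → Carrier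
  fromℕ n = n · 1#

------------------------------------------------------------------------
-- Ordered graphs

-- A finite linear order is isomorphic, in exactly one way, to Fin v with
-- its natural order, so the vertex set is taken to be Fin v.

record OrderedGraph : Set₁ where
  infix 4 _~_ _~?_
  field
    v      : ℕ
    _~_    : Rel (Fin v) 0ℓ
    _~?_   : B.Decidable _~_
    sym    : B.Symmetric _~_
    irrefl : B.Irreflexive _≡_ _~_

open OrderedGraph using (v)

e : OrderedGraph → ℕ
e G = length (filter (λ (x , y) → x Fin.<? y ×-dec x ~? y)
                     (cartesianProduct (allFin (v G)) (allFin (v G))))
  where open OrderedGraph G using (_~?_)

-- A coloring of the edges of the complete graph on Fin n: the color of the
-- edge with endpoints x < y is χ x y. Values χ x y with x ≥ y are never
-- consulted.

Coloring : ℕ → ℕ → Set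
Coloring n k = Fin n → Fin n → Fin k

-- Strict monotonicity subsumes injectivity.

IsCopy : Coloring n k → Fin k → (G : OrderedGraph) → Pred (Fin (v G) → Fin n) 0ℓ
IsCopy χ i G φ =
  ∀ x y → x Fin.< y → φ x Fin.< φ y × (x ~ y → χ (φ x) (φ y) ≡ i)
  where open OrderedGraph G using (_~_)

isCopy? : (χ : Coloring n k) (i : Fin k) (G : OrderedGraph) → Decidable (IsCopy χ i G)
isCopy? χ i G φ =
  Fin.all? λ x → Fin.all? λ y →
    x Fin.<? y →-dec (φ x Fin.<? φ y ×-dec (x ~? y →-dec χ (φ x) (φ y) Fin.≟ i))
  where open OrderedGraph G using (_~?_)

functions : ∀ m n → List (Fin m → Fin n)
functions m n = map finToFun (allFin (n ℕ.^ m))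

-- Copies are counted as maps; a strictly monotone map is determined by its
-- image, so this is also the number of vertex sets supporting a copy.

N : Coloring n k → Fin k → OrderedGraph → ℕ
N {n} χ i G = length (filter (isCopy? χ i G) (functions (v G) n))

colorings : ∀ n k → List (Coloring n k)
colorings n k = map (λ f x y → f (combine x y)) (functions (n ℕ.* n) k)

-- Families of k ≥ 1 graphs are indexed by Fin (suc m), where k = suc m.

h* : ∀ {m} → (Fin (suc m) → OrderedGraph) → ℕ
h* {m} 𝒢 = ℕ-Extrema.min (v (𝒢 zero)) (map (λ i → v (𝒢 i)) (allFin (suc m)))

I* : ∀ {m} → (Fin (suc m) → OrderedGraph) → Pred (Fin (suc m)) 0ℓ
I* 𝒢 i = v (𝒢 i) ≡ h* 𝒢

I*? : ∀ {m} (𝒢 : Fin (suc m) → OrderedGraph) → Decidable (I* 𝒢)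
I*? 𝒢 i = v (𝒢 i) ℕ.≟ h* 𝒢

------------------------------------------------------------------------
-- Real-valued notions

module Multiplicity {c ℓ₁ ℓ₂} (R : CompleteOrderedField c ℓ₁ ℓ₂) where

  open CompleteOrderedField R
  open Data.List.Extrema totalOrder using (min)

  -- The minimum of f over S exists and equals μ.

  IsMinimum : {A : Set a} → Pred A s → (A → Carrier) → Carrier → Set (a ⊔ s ⊔ ℓ₁ ⊔ ℓ₂)
  IsMinimum S f μ = (∃ λ x → S x × f x ≈ μ) × (∀ x → S x → μ ≤ f x)

  IsLimit : (ℕ → Carrier) → Carrier → Set (c ⊔ ℓ₁ ⊔ ℓ₂)
  IsLimit x l = ∀ ε → 0# < ε → ∃ λ n₀ → ∀ n → n₀ ℕ.≤ n → - ε < x n - l × x n - l < ε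

  -- r = x ^ (1 / d), for x ≥ 0 and d ≥ 1

  IsRoot : ℕ → Carrier → Carrier → Set (ℓ₁ ⊔ ℓ₂)
  IsRoot d x r = 0# ≤ r × r ^ d ≈ x

  sumOver : {I : Pred (Fin k) s} → Decidable I → (Fin k → Carrier) → Carrier
  sumOver I? f = sum (λ i → if does (I? i) then f i else 0#)

  -- Probability vectors indexed by I; coordinates outside I are irrelevant.

  Simplex : {I : Pred (Fin k) s} → Decidable I → Pred (Fin k → Carrier) (s ⊔ ℓ₁ ⊔ ℓ₂)
  Simplex {I = I} I? p = (∀ i → I i → 0# ≤ p i) × sumOver I? p ≈ 1#

  module _ {m} (wt : Fin (suc m) → Carrier) (𝒢 : Fin (suc m) → OrderedGraph) where

    weightedCount : Coloring n (suc m) → Carrier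
    weightedCount χ = sum (λ i → wt i * fromℕ (N χ i (𝒢 i)))

    M̄ : ℕ → Carrier
    M̄ n = min (weightedCount {n} (λ _ _ → zero)) (map weightedCount (colorings n (suc m)))

    -- π is the limit of M̄ n / (n C h*); the finitely many n < h*, where the
    -- denominator is 0#, do not affect it.

    IsWeightedMultiplicityConstant : Carrier → Set (c ⊔ ℓ₁ ⊔ ℓ₂)
    IsWeightedMultiplicityConstant = IsLimit (λ n → M̄ n * fromℕ (n C h* 𝒢) ⁻¹)

{-# OPTIONS --safe #-}

-- Color the pairs independently, giving a pair the color i with probability
-- p i. A strictly monotone map of the vertices of 𝒢 i is then monochromatic of
-- color i with probability p i ^ e (𝒢 i), and there are n C v (𝒢 i) such maps,
-- so some coloring does at least as well as the expected weighted count. For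
-- the bound on the limit, p is supported on I*; the bound on M̄ n is then a
-- constant multiple of n C h*. The minima exist because the objective is a
-- sum of Lipschitz functions of one coordinate each, so that the coordinates
-- can be minimized over one at a time.

module Submission where

open import Defs
open import Algebra.Bundles using (CommutativeRing)
import Algebra.Properties.CommutativeSemiring.Exp
import Algebra.Properties.Ring
import Algebra.Properties.Semiring.Exp
import Algebra.Properties.Semiring.Mult.TCOptimised
import Algebra.Properties.Semiring.Sum
import Algebra.Solver.Ring
open import Algebra.Solver.Ring.AlmostCommutativeRing using (fromCommutativeRing; _-Raw-AlmostCommutative⟶_)
open import Data.Bool.Base using (if_then_else_)
open import Data.Empty using (⊥; ⊥-elim)
open import Data.Fin.Base as Fin using (Fin; zero; suc; combine; finToFun; funToFin)
import Data.Fin.Properties as Fin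
open import Data.Integer.Base as ℤ using (ℤ)
import Data.Integer.Properties as ℤ
open import Data.List.Base as List
  using (List; []; _∷_; _++_; allFin; cartesianProduct; filter; length; lookup; map; tabulate)
import Data.List.Extrema
import Data.List.Extrema.Nat as ℕ-Extrema
open import Data.List.Membership.DecPropositional using () renaming (_∈?_ to member?)
open import Data.List.Membership.Propositional using (_∈_)
open import Data.List.Membership.Propositional.Properties
  using (∈-lookup; ∈-map⁺; ∈-map⁻; ∈-filter⁺; ∈-filter⁻; ∈-++⁺ˡ; ∈-++⁺ʳ; ∈-allFin)
open import Data.List.Membership.Setoid.Properties using (index-injective)
open import Data.List.Properties using (length-map; length-++; filter-≐)
open import Data.List.Relation.Binary.Subset.Propositional using (_⊆_)
open import Data.List.Relation.Unary.All as All using (_∷_)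
open import Data.List.Relation.Unary.All.Properties using (all-filter)
open import Data.List.Relation.Unary.AllPairs.Core using (_∷_)
open import Data.List.Relation.Unary.Any using (here; index)
open import Data.List.Relation.Unary.Unique.Propositional using (Unique)
import Data.List.Relation.Unary.Unique.Propositional.Properties as Unique
import Data.Maybe.Base as Maybe
open import Data.Nat.Base as ℕ using (ℕ; zero; suc; _∸_)
open import Data.Nat.Combinatorics using (_C_; nCk≡nC[n∸k]; nCn≡1; nCk+nC[k+1]≡[n+1]C[k+1]; k>n⇒nCk≡0)
import Data.Nat.Properties as ℕ
open import Data.Product.Base using (∃; _×_; _,_; proj₁; proj₂)
open import Data.Sign.Base as Sign using ()
open import Data.Sum.Base using (inj₁; inj₂)
open import Data.Unit.Base using (tt)
open import Data.Vec.Functional as Vector using () renaming (_∷_ to _◂_)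
open import Function.Base using (_∘_; id)
open import Level using (Level; Lift; lift; lower; _⊔_)
open import Relation.Binary.Bundles using (DecTotalOrder)
open import Relation.Binary.Consequences using (dec⇒weaklyDec)
open import Relation.Binary.Definitions using (tri<; tri≈; tri>)
import Relation.Binary.Properties.DecTotalOrder
open import Relation.Binary.PropositionalEquality as ≡ using (_≡_; _≗_)
import Relation.Binary.Reasoning.PartialOrder
import Relation.Binary.Reasoning.Setoid
open import Relation.Nullary.Decidable using (dec-true; dec-false)
open import Relation.Nullary.Decidable.Core using (Dec; yes; no; does; _→-dec_; _×-dec_)
open import Relation.Nullary.Negation.Core using (¬_)
open import Relation.Unary using (Pred; Decidable)
open import Relation.Unary.Properties using (U?)

-- Completeness is available only through suprema, so every minimum comes from a one-variable
-- argument on an interval `[0, b]`. Passing to the next coordinate requires the partial minimum, as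
-- a function of the available mass, to be again a function to which that argument applies.
-- Monotonicity is carried along with the Lipschitz bound for this reason: a minimizer for a larger
-- mass may not fit into a smaller one, and truncating it then costs nothing. The terms of the
-- objective are nonnegative multiples of powers, hence weakly increasing on nonnegative arguments.
--
-- On the probabilistic side only upper bounds are proved. A random coloring is a function on
-- `Fin (n * n)`, which includes the positions `x ≥ y` that no copy consults; such positions average
-- out because `p` has total mass 1. The closed form for a common exponent above 1 does not pass
-- through the minimum: it is the value of the objective at one explicit point of the simplex, and
-- its roots come from the intermediate value theorem.

private
  variable
    k m n : ℕ
    s : Level

-- A ring solver with integer coefficients.

module IntegerCoefficients {c ℓ} (R : CommutativeRing c ℓ) where

  open CommutativeRing R
  open import Data.Integer.Base using (+_; -[1+_]; _⊖_)
  open Algebra.Properties.Ring ring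
  open Algebra.Properties.Semiring.Mult.TCOptimised semiring renaming (_×_ to _·_)
  open Relation.Binary.Reasoning.Setoid setoid

  -- With this variant of the multiple, `1 · 1#` is `1#` by definition, so `con ℤ.1ℤ` in a solver
  -- call denotes `1#` itself.
  fromℤ : ℤ → Carrier
  fromℤ (+ n)    = n · 1#
  fromℤ -[1+ n ] = - (suc n · 1#)

  private
    cancel-1 : ∀ x y → (1# + x) - (1# + y) ≈ x - y
    cancel-1 x y = begin
      (1# + x) - (1# + y)     ≈⟨ +-congˡ (-‿+-comm 1# y) ⟨
      (1# + x) + (- 1# - y)   ≈⟨ +-congʳ (+-comm 1# x) ⟩
      (x + 1#) + (- 1# - y)   ≈⟨ +-assoc x 1# _ ⟩
      x + (1# + (- 1# - y))   ≈⟨ +-congˡ (+-assoc 1# (- 1#) (- y)) ⟨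
      x + ((1# - 1#) - y)     ≈⟨ +-congˡ (+-congʳ (-‿inverseʳ 1#)) ⟩
      x + (0# - y)            ≈⟨ +-congˡ (+-identityˡ (- y)) ⟩
      x - y                   ∎

  fromℤ-⊖ : ∀ m n → fromℤ (m ⊖ n) ≈ m · 1# - n · 1#
  fromℤ-⊖ zero    zero    = sym (-‿inverseʳ 0#)
  fromℤ-⊖ zero    (suc n) = sym (+-identityˡ _)
  fromℤ-⊖ (suc m) zero    = sym (trans (+-congˡ -0#≈0#) (+-identityʳ _))
  fromℤ-⊖ (suc m) (suc n) = begin
    fromℤ (suc m ⊖ suc n)            ≡⟨ ≡.cong fromℤ (ℤ.[1+m]⊖[1+n]≡m⊖n m n) ⟩
    fromℤ (m ⊖ n)                    ≈⟨ fromℤ-⊖ m n ⟩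
    m · 1# - n · 1#                  ≈⟨ cancel-1 _ _ ⟨
    (1# + m · 1#) - (1# + n · 1#)    ≈⟨ +-cong (1+× m 1#) (-‿cong (1+× n 1#)) ⟨
    suc m · 1# - suc n · 1#          ∎

  fromℤ-+ : ∀ i j → fromℤ (i ℤ.+ j) ≈ fromℤ i + fromℤ j
  fromℤ-+ (+ m)    (+ n)    = ×-homo-+ 1# m n
  fromℤ-+ (+ m)    -[1+ n ] = fromℤ-⊖ m (suc n)
  fromℤ-+ -[1+ m ] (+ n)    = trans (fromℤ-⊖ n (suc m)) (+-comm _ _)
  fromℤ-+ -[1+ m ] -[1+ n ] = trans
    (-‿cong (trans (reflexive (≡.cong (λ k → suc k · 1#) (≡.sym (ℕ.+-suc m n)))) (×-homo-+ 1# (suc m) (suc n))))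
    (sym (-‿+-comm _ _))

  fromℤ-neg : ∀ i → fromℤ (ℤ.- i) ≈ - fromℤ i
  fromℤ-neg (+ zero)  = sym -0#≈0#
  fromℤ-neg (+ suc n) = refl
  fromℤ-neg -[1+ n ]  = sym (-‿involutive _)

  fromℤ--◃ : ∀ n → fromℤ (Sign.- ℤ.◃ n) ≈ - (n · 1#)
  fromℤ--◃ n = trans (reflexive (≡.cong fromℤ (ℤ.-◃n≡-n n))) (fromℤ-neg (+ n))

  fromℤ-* : ∀ i j → fromℤ (i ℤ.* j) ≈ fromℤ i * fromℤ j
  fromℤ-* (+ m)    (+ n)    = trans (reflexive (≡.cong fromℤ (ℤ.+◃n≡+n (m ℕ.* n)))) (×1-homo-* m n)
  fromℤ-* (+ m)    -[1+ n ] = trans (fromℤ--◃ (m ℕ.* suc n))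
    (trans (-‿cong (×1-homo-* m (suc n))) (-‿distribʳ-* _ _))
  fromℤ-* -[1+ m ] (+ n)    = trans (fromℤ--◃ (suc m ℕ.* n))
    (trans (-‿cong (×1-homo-* (suc m) n)) (-‿distribˡ-* _ _))
  fromℤ-* -[1+ m ] -[1+ n ] = begin
    fromℤ (Sign.+ ℤ.◃ (suc m ℕ.* suc n))  ≡⟨ ≡.cong fromℤ (ℤ.+◃n≡+n (suc m ℕ.* suc n)) ⟩
    (suc m ℕ.* suc n) · 1#                ≈⟨ ×1-homo-* (suc m) (suc n) ⟩
    suc m · 1# * suc n · 1#               ≈⟨ -‿involutive _ ⟨
    - - (suc m · 1# * suc n · 1#)         ≈⟨ -‿cong (-‿distribˡ-* _ _) ⟩
    - (- (suc m · 1#) * suc n · 1#)       ≈⟨ -‿distribʳ-* _ _ ⟩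
    - (suc m · 1#) * - (suc n · 1#)       ∎

  -- The solver has to see coefficients such as `1 - 1` vanish by computation. Equality in an
  -- abstract ring does not reduce, equality of integers does.
  morphism : ℤ.+-*-rawRing -Raw-AlmostCommutative⟶ fromCommutativeRing R
  morphism = record
    { ⟦_⟧    = fromℤ
    ; +-homo = fromℤ-+
    ; *-homo = fromℤ-*
    ; -‿homo = fromℤ-neg
    ; 0-homo = refl
    ; 1-homo = refl
    }

  open Algebra.Solver.Ring ℤ.+-*-rawRing (fromCommutativeRing R) morphism
    (λ i j → Maybe.map (λ i≡j → reflexive (≡.cong fromℤ i≡j)) (dec⇒weaklyDec ℤ._≟_ i j)) public

-- Arithmetic of ordered fields.

module OrderedField {c ℓ₁ ℓ₂} (R : CompleteOrderedField c ℓ₁ ℓ₂) where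

  open CompleteOrderedField R public
  open CommutativeRing commutativeRing public
    using ( +-assoc; +-comm; +-cong; +-congˡ; +-congʳ; +-identityˡ; +-identityʳ
          ; -‿inverseʳ; *-assoc; *-comm; *-cong; *-congˡ; *-congʳ
          ; *-identityˡ; *-identityʳ; distribˡ; zeroˡ; zeroʳ
          ; commutativeSemiring)
    renaming (refl to ≈-refl; sym to ≈-sym; trans to ≈-trans; reflexive to ≈-reflexive)
  open DecTotalOrder decTotalOrder public
    using (_≤?_; antisym; ≤-respˡ-≈; ≤-respʳ-≈)
    renaming (refl to ≤-refl; reflexive to ≤-reflexive; trans to ≤-trans; total to ≤-total; poset to ≤-poset)
  open Relation.Binary.Properties.DecTotalOrder decTotalOrder public
    using (≰⇒>; <⇒≱)
  open Algebra.Properties.Semiring.Sum semiring public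
    using (sum-cong-≋; sum-replicate-zero; ∑-distrib-+; *-distribˡ-sum; *-distribʳ-sum)
  open IntegerCoefficients commutativeRing public
    using (solve; _:=_; _:+_; _:*_; _:-_; :-_; con)
  module ≤-Reasoning = Relation.Binary.Reasoning.PartialOrder ≤-poset

  open ≤-Reasoning

  <⇒≤ : ∀ {x y} → x < y → x ≤ y
  <⇒≤ = proj₁

  <-≤-trans : ∀ {x y z} → x < y → y ≤ z → x < z
  <-≤-trans x<y y≤z = begin-strict _ <⟨ x<y ⟩ _ ≤⟨ y≤z ⟩ _ ∎

  ≤-<-trans : ∀ {x y z} → x ≤ y → y < z → x < z
  ≤-<-trans x≤y y<z = begin-strict _ ≤⟨ x≤y ⟩ _ <⟨ y<z ⟩ _ ∎

  <-irrefl : ∀ {x} → ¬ x < x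
  <-irrefl x<x = <⇒≱ x<x ≤-refl

  +-monoʳ-≤ : ∀ z {x y} → x ≤ y → z + x ≤ z + y
  +-monoʳ-≤ z {x} {y} x≤y = begin
    z + x  ≈⟨ +-comm z x ⟩
    x + z  ≤⟨ +-monoˡ-≤ z x≤y ⟩
    y + z  ≈⟨ +-comm y z ⟩
    z + y  ∎

  +-mono-≤ : ∀ {x y u v} → x ≤ y → u ≤ v → x + u ≤ y + v
  +-mono-≤ x≤y u≤v = ≤-trans (+-monoˡ-≤ _ x≤y) (+-monoʳ-≤ _ u≤v)

  +-cancelʳ-≤ : ∀ z {x y} → x + z ≤ y + z → x ≤ y
  +-cancelʳ-≤ z {x} {y} h = begin
    x            ≈⟨ solve 2 (λ x z → x := x :+ z :- z) ≈-refl x z ⟩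
    x + z - z    ≤⟨ +-monoˡ-≤ (- z) h ⟩
    y + z - z    ≈⟨ solve 2 (λ y z → y :+ z :- z := y) ≈-refl y z ⟩
    y            ∎

  +-monoˡ-< : ∀ z {x y} → x < y → x + z < y + z
  +-monoˡ-< z x<y = ≰⇒> (λ h → <⇒≱ x<y (+-cancelʳ-≤ z h))

  +-monoʳ-< : ∀ z {x y} → x < y → z + x < z + y
  +-monoʳ-< z {x} {y} x<y = begin-strict
    z + x  ≈⟨ +-comm z x ⟩
    x + z  <⟨ +-monoˡ-< z x<y ⟩
    y + z  ≈⟨ +-comm y z ⟩
    z + y  ∎

  +-cancelʳ-< : ∀ z {x y} → x + z < y + z → x < y
  +-cancelʳ-< z h = ≰⇒> (λ y≤x → <⇒≱ h (+-monoˡ-≤ z y≤x))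

  x≤y⇒0≤y-x : ∀ {x y} → x ≤ y → 0# ≤ y - x
  x≤y⇒0≤y-x {x} {y} x≤y = ≤-respˡ-≈ (-‿inverseʳ x) (+-monoˡ-≤ (- x) x≤y)

  x<y⇒0<y-x : ∀ {x y} → x < y → 0# < y - x
  x<y⇒0<y-x {x} {y} x<y = begin-strict
    0#     ≈⟨ -‿inverseʳ x ⟨
    x - x  <⟨ +-monoˡ-< (- x) x<y ⟩
    y - x  ∎

  x≤y+z⇒x-y≤z : ∀ {x y z} → x ≤ y + z → x - y ≤ z
  x≤y+z⇒x-y≤z {x} {y} {z} h = +-cancelʳ-≤ y (begin
    x - y + y  ≈⟨ solve 2 (λ x y → x :- y :+ y := x) ≈-refl x y ⟩
    x          ≤⟨ h ⟩
    y + z      ≈⟨ +-comm y z ⟩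
    z + y      ∎)

  x≤x+y : ∀ {x y} → 0# ≤ y → x ≤ x + y
  x≤x+y {x} 0≤y = ≤-respˡ-≈ (+-identityʳ x) (+-monoʳ-≤ x 0≤y)

  x<x+y : ∀ {x y} → 0# < y → x < x + y
  x<x+y {x} {y} 0<y = begin-strict
    x       ≈⟨ +-identityʳ x ⟨
    x + 0#  <⟨ +-monoʳ-< x 0<y ⟩
    x + y   ∎

  x-y≤x : ∀ {x y} → 0# ≤ y → x - y ≤ x
  x-y≤x 0≤y = x≤y+z⇒x-y≤z (≤-respʳ-≈ (+-comm _ _) (x≤x+y 0≤y))

  +-nonNeg : ∀ {x y} → 0# ≤ x → 0# ≤ y → 0# ≤ x + y
  +-nonNeg 0≤x 0≤y = ≤-trans 0≤x (x≤x+y 0≤y)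

  *-monoˡ-≤ : ∀ {x y z} → 0# ≤ z → x ≤ y → z * x ≤ z * y
  *-monoˡ-≤ {x} {y} {z} 0≤z x≤y = begin
    z * x                  ≤⟨ x≤x+y (*-nonNeg 0≤z (x≤y⇒0≤y-x x≤y)) ⟩
    z * x + z * (y - x)    ≈⟨ solve 3 (λ x y z → z :* x :+ z :* (y :- x) := z :* y) ≈-refl x y z ⟩
    z * y                  ∎

  *-monoʳ-≤ : ∀ {x y z} → 0# ≤ z → x ≤ y → x * z ≤ y * z
  *-monoʳ-≤ {x} {y} {z} 0≤z x≤y = begin
    x * z  ≈⟨ *-comm x z ⟩
    z * x  ≤⟨ *-monoˡ-≤ 0≤z x≤y ⟩
    z * y  ≈⟨ *-comm z y ⟩
    y * z  ∎

  0≤1 : 0# ≤ 1#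
  0≤1 with ≤-total 0# 1#
  ... | inj₁ 0≤1 = 0≤1
  -- Here `0# - 1#` is nonnegative, hence so is its square, which is `1#`.
  ... | inj₂ 1≤0 = ≤-respʳ-≈ (solve 0 ((con ℤ.0ℤ :- con ℤ.1ℤ) :* (con ℤ.0ℤ :- con ℤ.1ℤ) := con ℤ.1ℤ) ≈-refl)
    (*-nonNeg (x≤y⇒0≤y-x 1≤0) (x≤y⇒0≤y-x 1≤0))

  0<1 : 0# < 1#
  0<1 = 0≤1 , 0≉1

  >⇒≉0 : ∀ {x} → 0# < x → ¬ x ≈ 0#
  >⇒≉0 (_ , 0≉x) x≈0 = 0≉x (≈-sym x≈0)

  ⁻¹-nonNeg : ∀ {x} → 0# < x → 0# ≤ x ⁻¹
  ⁻¹-nonNeg {x} 0<x with ≤-total 0# (x ⁻¹)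
  ... | inj₁ 0≤x⁻¹ = 0≤x⁻¹
  ... | inj₂ x⁻¹≤0 = ⊥-elim (<⇒≱ 0<1 (begin
    1#        ≈⟨ *-inverseʳ x (>⇒≉0 0<x) ⟨
    x * x ⁻¹  ≤⟨ *-monoˡ-≤ (<⇒≤ 0<x) x⁻¹≤0 ⟩
    x * 0#    ≈⟨ zeroʳ x ⟩
    0#        ∎))

  *-pos : ∀ {x y} → 0# < x → 0# < y → 0# < x * y
  *-pos {x} {y} 0<x 0<y = *-nonNeg (<⇒≤ 0<x) (<⇒≤ 0<y) , λ 0≈xy → >⇒≉0 0<y (begin-equality
    y               ≈⟨ *-identityʳ y ⟨
    y * 1#          ≈⟨ *-congˡ (*-inverseʳ x (>⇒≉0 0<x)) ⟨
    y * (x * x ⁻¹)  ≈⟨ solve 3 (λ x x′ y → y :* (x :* x′) := x :* y :* x′) ≈-refl x (x ⁻¹) y ⟩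
    x * y * x ⁻¹    ≈⟨ *-congʳ 0≈xy ⟨
    0# * x ⁻¹       ≈⟨ zeroˡ (x ⁻¹) ⟩
    0#              ∎)

  ⁻¹-pos : ∀ {x} → 0# < x → 0# < x ⁻¹
  ⁻¹-pos {x} 0<x = ⁻¹-nonNeg 0<x , λ 0≈x⁻¹ → 0≉1 (begin-equality
    0#         ≈⟨ zeroʳ x ⟨
    x * 0#     ≈⟨ *-congˡ 0≈x⁻¹ ⟩
    x * x ⁻¹   ≈⟨ *-inverseʳ x (>⇒≉0 0<x) ⟩
    1#         ∎)

  *-monoˡ-< : ∀ {x y z} → 0# < z → x < y → z * x < z * y
  *-monoˡ-< {x} {y} {z} 0<z x<y = begin-strict
    z * x                  <⟨ x<x+y (*-pos 0<z (x<y⇒0<y-x x<y)) ⟩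
    z * x + z * (y - x)    ≈⟨ solve 3 (λ x y z → z :* x :+ z :* (y :- x) := z :* y) ≈-refl x y z ⟩
    z * y                  ∎

  ^-nonNeg : ∀ n {x} → 0# ≤ x → 0# ≤ x ^ n
  ^-nonNeg zero    0≤x = 0≤1
  ^-nonNeg (suc n) 0≤x = *-nonNeg 0≤x (^-nonNeg n 0≤x)

  ^-pos : ∀ n {x} → 0# < x → 0# < x ^ n
  ^-pos zero    0<x = 0<1
  ^-pos (suc n) 0<x = *-pos 0<x (^-pos n 0<x)

  ^-monoˡ-≤ : ∀ n {x y} → 0# ≤ x → x ≤ y → x ^ n ≤ y ^ n
  ^-monoˡ-≤ zero    0≤x x≤y = ≤-refl
  ^-monoˡ-≤ (suc n) 0≤x x≤y =
    ≤-trans (*-monoʳ-≤ (^-nonNeg n 0≤x) x≤y) (*-monoˡ-≤ (≤-trans 0≤x x≤y) (^-monoˡ-≤ n 0≤x x≤y))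

  ^-≤1 : ∀ n {x} → 0# ≤ x → x ≤ 1# → x ^ n ≤ 1#
  ^-≤1 zero    0≤x x≤1 = ≤-refl
  ^-≤1 (suc n) {x} 0≤x x≤1 = begin
    x * x ^ n  ≤⟨ *-monoˡ-≤ 0≤x (^-≤1 n 0≤x x≤1) ⟩
    x * 1#     ≈⟨ *-identityʳ x ⟩
    x          ≤⟨ x≤1 ⟩
    1#         ∎

  ^-antimonoʳ-≤ : ∀ {m n x} → 0# ≤ x → x ≤ 1# → m ℕ.≤ n → x ^ n ≤ x ^ m
  ^-antimonoʳ-≤ {n = n} 0≤x x≤1 ℕ.z≤n = ^-≤1 n 0≤x x≤1
  ^-antimonoʳ-≤ 0≤x x≤1 (ℕ.s≤s m≤n)   = *-monoˡ-≤ 0≤x (^-antimonoʳ-≤ 0≤x x≤1 m≤n)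

  0^n≈0 : ∀ {n} → 1 ℕ.≤ n → 0# ^ n ≈ 0#
  0^n≈0 {suc n} _ = zeroˡ _

  fromℕ-nonNeg : ∀ n → 0# ≤ fromℕ n
  fromℕ-nonNeg zero    = ≤-refl
  fromℕ-nonNeg (suc n) = +-nonNeg 0≤1 (fromℕ-nonNeg n)

  fromℕ-mono-≤ : ∀ {m n} → m ℕ.≤ n → fromℕ m ≤ fromℕ n
  fromℕ-mono-≤ {n = n} ℕ.z≤n   = fromℕ-nonNeg n
  fromℕ-mono-≤ (ℕ.s≤s m≤n) = +-monoʳ-≤ 1# (fromℕ-mono-≤ m≤n)

  fromℕ-pos : ∀ {n} → 1 ℕ.≤ n → 0# < fromℕ n
  fromℕ-pos {suc n} _ = <-≤-trans 0<1 (x≤x+y (fromℕ-nonNeg n))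

  sum-mono-≤ : ∀ {n} {f g : Fin n → Carrier} → (∀ i → f i ≤ g i) → sum f ≤ sum g
  sum-mono-≤ {zero}  f≤g = ≤-refl
  sum-mono-≤ {suc n} f≤g = +-mono-≤ (f≤g zero) (sum-mono-≤ (f≤g ∘ suc))

  sum-nonNeg : ∀ {n} {f : Fin n → Carrier} → (∀ i → 0# ≤ f i) → 0# ≤ sum f
  sum-nonNeg {zero}  0≤f = ≤-refl
  sum-nonNeg {suc n} 0≤f = +-nonNeg (0≤f zero) (sum-nonNeg (0≤f ∘ suc))

  term≤sum : ∀ {n} {f : Fin n → Carrier} → (∀ i → 0# ≤ f i) → ∀ i → f i ≤ sum f
  term≤sum 0≤f zero    = x≤x+y (sum-nonNeg (0≤f ∘ suc))
  term≤sum {f = f} 0≤f (suc i) = ≤-trans (term≤sum (0≤f ∘ suc) i)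
    (≤-respʳ-≈ (+-comm _ _) (x≤x+y (0≤f zero)))

-- Extreme and intermediate values of Lipschitz functions on an interval.

module Continuity {c ℓ₁ ℓ₂} (R : CompleteOrderedField c ℓ₁ ℓ₂) where

  open OrderedField R
  open ≤-Reasoning

  infix 4 _∈[0,_]
  _∈[0,_] : Carrier → Carrier → Set ℓ₂
  x ∈[0, b ] = 0# ≤ x × x ≤ b

  -- Two one-sided inequalities for ordered pairs replace an absolute value. Strict positivity of
  -- the constant allows dividing by it.
  Lipschitz : Carrier → (Carrier → Carrier) → Set (c ⊔ ℓ₁ ⊔ ℓ₂)
  Lipschitz b f = ∃ λ L → 0# < L × (∀ {x y} → 0# ≤ x → x ≤ y → y ≤ b →
    f x ≤ f y + L * (y - x) × f y ≤ f x + L * (y - x))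

  -- A function on the carrier need not respect `≈`; a Lipschitz bound at distance zero supplies
  -- this.
  Lipschitz⇒cong : ∀ {b f} → Lipschitz b f → ∀ {x y} → x ∈[0, b ] → y ≤ b → x ≈ y → f x ≈ f y
  Lipschitz⇒cong {b} {f} (L , _ , lip) {x} {y} (0≤x , _) y≤b x≈y = antisym
    (≤-respʳ-≈ (drop (f y)) (proj₁ bounds)) (≤-respʳ-≈ (drop (f x)) (proj₂ bounds))
    where
    bounds = lip 0≤x (≤-reflexive x≈y) y≤b
    drop : ∀ u → u + L * (y - x) ≈ u
    drop u = begin-equality
      u + L * (y - x)  ≈⟨ +-congˡ (*-congˡ (+-congʳ x≈y)) ⟨
      u + L * (x - x)  ≈⟨ solve 3 (λ u L x → u :+ L :* (x :- x) := u) ≈-refl u L x ⟩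
      u                ∎

  -- The radius δ = d / L turns a Lipschitz bound into f y - f x < d.

  record Modulus (b : Carrier) (f : Carrier → Carrier) (d : Carrier) : Set (c ⊔ ℓ₁ ⊔ ℓ₂) where
    field
      δ     : Carrier
      0<δ   : 0# < δ
      up    : ∀ {x y} → 0# ≤ x → x ≤ y → y ≤ b → y < x + δ → f y < f x + d
      down  : ∀ {x y} → 0# ≤ x → x ≤ y → y ≤ b → y < x + δ → f x < f y + d
      step  : ∀ {x} → 0# ≤ x → x + δ ≤ b → f (x + δ) ≤ f x + d

  modulus : ∀ {b f} → Lipschitz b f → ∀ {d} → 0# < d → Modulus b f d
  modulus {b} {f} (L , 0<L , lip) {d} 0<d = record
    { δ    = d * L ⁻¹
    ; 0<δ  = 0<δ
    ; up   = λ 0≤x x≤y y≤b y<x+δ → ≤-<-trans (proj₂ (lip 0≤x x≤y y≤b)) (+-monoʳ-< _ (small y<x+δ))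
    ; down = λ 0≤x x≤y y≤b y<x+δ → ≤-<-trans (proj₁ (lip 0≤x x≤y y≤b)) (+-monoʳ-< _ (small y<x+δ))
    ; step = λ {x} 0≤x x+δ≤b → ≤-respʳ-≈ (+-congˡ (exact x)) (proj₂ (lip 0≤x (x≤x+y (<⇒≤ 0<δ)) x+δ≤b))
    }
    where
    0<δ : 0# < d * L ⁻¹
    0<δ = *-pos 0<d (⁻¹-pos 0<L)

    exact : ∀ x → L * (x + d * L ⁻¹ - x) ≈ d
    exact x = begin-equality
      L * (x + d * L ⁻¹ - x)   ≈⟨ solve 4 (λ L L′ x d → L :* (x :+ d :* L′ :- x) := d :* (L :* L′)) ≈-refl L (L ⁻¹) x d ⟩
      d * (L * L ⁻¹)           ≈⟨ *-congˡ (*-inverseʳ L (>⇒≉0 0<L)) ⟩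
      d * 1#                   ≈⟨ *-identityʳ d ⟩
      d                        ∎

    small : ∀ {x y} → y < x + d * L ⁻¹ → L * (y - x) < d
    small {x} {y} y<x+δ = begin-strict
      L * (y - x)              <⟨ *-monoˡ-< 0<L (+-monoˡ-< (- x) y<x+δ) ⟩
      L * (x + d * L ⁻¹ - x)   ≈⟨ exact x ⟩
      d                        ∎

  x-δ<y⇒x<y+δ : ∀ {x y δ} → x - δ < y → x < y + δ
  x-δ<y⇒x<y+δ {x} {y} {δ} h = begin-strict
    x          ≈⟨ solve 2 (λ x δ → x := x :- δ :+ δ) ≈-refl x δ ⟩
    x - δ + δ  <⟨ +-monoˡ-< δ h ⟩
    y + δ      ∎

  x-δ≱x : ∀ {x δ} → 0# < δ → ¬ x ≤ x - δ
  x-δ≱x {x} {δ} 0<δ h = <-irrefl (<-≤-trans (x<x+y 0<δ) (begin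
    x + δ      ≤⟨ +-monoˡ-≤ δ h ⟩
    x - δ + δ  ≈⟨ solve 2 (λ x δ → x :- δ :+ δ := x) ≈-refl x δ ⟩
    x          ∎))

  ≮⇒≥ : ∀ {x y} → ¬ x < y → y ≤ x
  ≮⇒≥ {x} {y} x≮y with y ≤? x
  ... | yes y≤x = y≤x
  ... | no  y≰x = ⊥-elim (x≮y (≰⇒> y≰x))

  a+[b-a]≈b : ∀ a b → a + (b - a) ≈ b
  a+[b-a]≈b = solve 2 (λ a b → a :+ (b :- a) := b) ≈-refl

  -- The minimum is attained at the supremum z of the points x such that f
  -- takes a value below all its values on [0, x): a value below f z would
  -- also be below the values of f near z, and x could be pushed beyond z.

  minimum-attained : ∀ {b f} → 0# ≤ b → Lipschitz b f →
    ∃ λ z → z ∈[0, b ] × (∀ y → y ∈[0, b ] → f z ≤ f y)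
  minimum-attained {b} {f} 0≤b lip = z , (0≤z , z≤b) , minimal
    where
    Beaten : Pred Carrier (c ⊔ ℓ₁ ⊔ ℓ₂)
    Beaten x = x ∈[0, b ] × ∃ λ w → w ∈[0, b ] × (∀ y → 0# ≤ y → y < x → f w < f y)

    beaten-0 : Beaten 0#
    beaten-0 = (≤-refl , 0≤b) , 0# , (≤-refl , 0≤b) , λ y 0≤y y<0 → ⊥-elim (<⇒≱ y<0 0≤y)

    sup = supremum Beaten (0# , beaten-0) (b , λ _ beaten → proj₂ (proj₁ beaten))
    z = proj₁ sup
    upper = proj₁ (proj₂ sup)
    least = proj₂ (proj₂ sup)

    0≤z : 0# ≤ z
    0≤z = upper 0# beaten-0

    z≤b : z ≤ b
    z≤b = least b (λ _ beaten → proj₂ (proj₁ beaten))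

    module _ {u} (u∈ : u ∈[0, b ]) (fu<fz : f u < f z) where

      open Modulus (modulus lip (x<y⇒0<y-x fu<fz))

      d = f z - f u

      near : ∀ y → y ∈[0, b ] → z < y + δ → y < z + δ → f u < f y
      near y (0≤y , y≤b) z<y+δ y<z+δ = +-cancelʳ-< d (≤-<-trans (≤-reflexive (a+[b-a]≈b (f u) (f z))) fz<fy+d)
        where
        fz<fy+d : f z < f y + d
        fz<fy+d with ≤-total z y
        ... | inj₁ z≤y = down 0≤z z≤y y≤b y<z+δ
        ... | inj₂ y≤z = up 0≤y y≤z z≤b z<y+δ

      module _ {x} (x-beaten : Beaten x) (z-δ<x : z - δ < x) where

        w = proj₁ (proj₂ x-beaten)

        -- The smaller of the two values beats both ranges at once: `f w` is below `f` on `[0, x)`,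
        -- and `f u` is below `f` within `δ` of `z`.
        better : ∃ λ w′ → w′ ∈[0, b ] × f w′ ≤ f w × f w′ ≤ f u
        better with ≤-total (f w) (f u)
        ... | inj₁ fw≤fu = w , proj₁ (proj₂ (proj₂ x-beaten)) , ≤-refl , fw≤fu
        ... | inj₂ fu≤fw = u , u∈ , fu≤fw , ≤-refl

        w′ = proj₁ better
        w′∈ = proj₁ (proj₂ better)

        below : ∀ y → y ∈[0, b ] → y < z + δ → f w′ < f y
        below y y∈ y<z+δ with x ≤? y
        ... | yes x≤y = ≤-<-trans (proj₂ (proj₂ (proj₂ better)))
                (near y y∈ (x-δ<y⇒x<y+δ (<-≤-trans z-δ<x x≤y)) y<z+δ)
        ... | no  x≰y = ≤-<-trans (proj₁ (proj₂ (proj₂ better)))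
                (proj₂ (proj₂ (proj₂ x-beaten)) y (proj₁ y∈) (≰⇒> x≰y))

        absurd : ⊥
        absurd with z + δ ≤? b
        ... | yes z+δ≤b = <⇒≱ (x<x+y 0<δ) (upper (z + δ)
                ( (+-nonNeg 0≤z (<⇒≤ 0<δ) , z+δ≤b) , w′ , w′∈
                , λ y 0≤y y<z+δ → below y (0≤y , ≤-trans (<⇒≤ y<z+δ) z+δ≤b) y<z+δ))
        -- Now all of `[0, b]` lies below `z + δ`, including `w′`, whose value would be less than
        -- itself.
        ... | no  z+δ≰b = <-irrefl (below w′ w′∈ (≤-<-trans (proj₂ w′∈) (≰⇒> z+δ≰b)))

      impossible : ⊥
      -- No beaten point exceeds `z - δ`, so `z - δ` is an upper bound below the least one.
      impossible = x-δ≱x 0<δ (least (z - δ) λ x x-beaten → bound x x-beaten)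
        where
        bound : ∀ x → Beaten x → x ≤ z - δ
        bound x x-beaten with x ≤? z - δ
        ... | yes x≤z-δ = x≤z-δ
        ... | no  x≰z-δ = ⊥-elim (absurd x-beaten (≰⇒> x≰z-δ))

    minimal : ∀ u → u ∈[0, b ] → f z ≤ f u
    minimal u u∈ with f z ≤? f u
    ... | yes fz≤fu = fz≤fu
    ... | no  fz≰fu = ⊥-elim (impossible u∈ (≰⇒> fz≰fu))

  -- The point is the supremum `z` of all `x` with `f x ≤ v`; monotonicity is not assumed. If `f z`
  -- exceeded `v`, so would `f` on the part of the set within `δ` to the left of `z`, and `z - δ`
  -- would be a smaller upper bound. If `f z` were less than `v`, either `z + δ` would belong to the
  -- set, or `b` would be so close to `z` that `f b < v`.
  intermediate-value : ∀ {b f v} → 0# ≤ b → Lipschitz b f → f 0# ≤ v → v ≤ f b →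
    ∃ λ z → z ∈[0, b ] × f z ≈ v
  intermediate-value {b} {f} {v} 0≤b lip f0≤v v≤fb = z , (0≤z , z≤b) , antisym fz≤v v≤fz
    where
    Below : Pred Carrier (c ⊔ ℓ₁ ⊔ ℓ₂)
    -- `Lift` only raises the predicate to the level at which `supremum` is stated.
    Below x = Lift (c ⊔ ℓ₁) (x ∈[0, b ] × f x ≤ v)

    below-0 : Below 0#
    below-0 = lift ((≤-refl , 0≤b) , f0≤v)

    sup = supremum Below (0# , below-0) (b , λ _ below → proj₂ (proj₁ (lower below)))
    z = proj₁ sup
    upper = proj₁ (proj₂ sup)
    least = proj₂ (proj₂ sup)

    0≤z : 0# ≤ z
    0≤z = upper 0# below-0

    z≤b : z ≤ b
    z≤b = least b (λ _ below → proj₂ (proj₁ (lower below)))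

    fz≤v : f z ≤ v
    fz≤v = ≮⇒≥ λ v<fz →
      let open Modulus (modulus lip (x<y⇒0<y-x v<fz)) in
      x-δ≱x 0<δ (least (z - δ) λ { x below@(lift ((0≤x , _) , fx≤v)) → ≮⇒≥ λ z-δ<x →
        <⇒≱ (+-cancelʳ-< (f z - v) (≤-<-trans (≤-reflexive (a+[b-a]≈b v (f z)))
          (up 0≤x (upper x below) z≤b (x-δ<y⇒x<y+δ z-δ<x)))) fx≤v })

    v≤fz : v ≤ f z
    v≤fz = ≮⇒≥ λ fz<v →
      let open Modulus (modulus lip (x<y⇒0<y-x fz<v)) in
      <⇒≱ (x<x+y 0<δ) (upper (z + δ) (past fz<v 0<δ up step))
      where
      past : ∀ {δ} → f z < v → 0# < δ →
        (∀ {x y} → 0# ≤ x → x ≤ y → y ≤ b → y < x + δ → f y < f x + (v - f z)) →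
        (∀ {x} → 0# ≤ x → x + δ ≤ b → f (x + δ) ≤ f x + (v - f z)) → Below (z + δ)
      past {δ} fz<v 0<δ up step with z + δ ≤? b
      -- The distance is exactly `δ`, where `up` is silent; `step` covers it with a weak inequality,
      -- which is all that membership asks for.
      ... | yes z+δ≤b = lift ((+-nonNeg 0≤z (<⇒≤ 0<δ) , z+δ≤b) , ≤-respʳ-≈ (a+[b-a]≈b (f z) v) (step 0≤z z+δ≤b))
      ... | no  z+δ≰b = ⊥-elim (<⇒≱ (<-≤-trans (up 0≤z z≤b ≤-refl (≰⇒> z+δ≰b)) (≤-reflexive (a+[b-a]≈b (f z) v))) v≤fb)

-- Minima of separable functions over a simplex, and roots.

module SimplexMinimum {c ℓ₁ ℓ₂} (R : CompleteOrderedField c ℓ₁ ℓ₂) where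

  open OrderedField R
  open Continuity R
  open Multiplicity R
  open ≤-Reasoning

  -- Weakly increasing with slopes at most `L`. This class, unlike that of a particular family of
  -- powers, is closed under infimal convolution.
  Increasing : Carrier → (Carrier → Carrier) → Set (c ⊔ ℓ₁ ⊔ ℓ₂)
  Increasing b f = ∃ λ L → 0# < L × (∀ {x y} → 0# ≤ x → x ≤ y → y ≤ b →
    f x ≤ f y × f y ≤ f x + L * (y - x))

  Increasing⇒Lipschitz : ∀ {b f} → Increasing b f → Lipschitz b f
  Increasing⇒Lipschitz (L , 0<L , inc) = L , 0<L , λ 0≤x x≤y y≤b →
    ≤-trans (proj₁ (inc 0≤x x≤y y≤b)) (x≤x+y (*-nonNeg (<⇒≤ 0<L) (x≤y⇒0≤y-x x≤y))) ,
    proj₂ (inc 0≤x x≤y y≤b)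

  ^-increasing : ∀ {b} → 0# < b → ∀ d → Increasing b (_^ d)
  ^-increasing {b} 0<b zero = 1# , 0<1 , λ _ x≤y _ →
    ≤-refl , x≤x+y (*-nonNeg 0≤1 (x≤y⇒0≤y-x x≤y))
  ^-increasing {b} 0<b (suc d) with L , 0<L , inc ← ^-increasing 0<b d =
    -- The constant comes from bounding `y` and `x` by `b` in
    -- `y * (y ^ d - x ^ d) + x ^ d * (y - x)`, which equals the increment of the next power.
    b * L + b ^ d , <-≤-trans (*-pos 0<b 0<L) (x≤x+y (^-nonNeg d (<⇒≤ 0<b))) , λ {x} {y} 0≤x x≤y y≤b →
    let 0≤y = ≤-trans 0≤x x≤y
        0≤y-x = x≤y⇒0≤y-x x≤y
    in ^-monoˡ-≤ (suc d) 0≤x x≤y , (begin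
      y * y ^ d
        ≤⟨ *-monoˡ-≤ 0≤y (proj₂ (inc 0≤x x≤y y≤b)) ⟩
      y * (x ^ d + L * (y - x))
        ≈⟨ solve 4 (λ x y u L → y :* (u :+ L :* (y :- x)) := x :* u :+ (y :* (L :* (y :- x)) :+ u :* (y :- x)))
             ≈-refl x y (x ^ d) L ⟩
      x * x ^ d + (y * (L * (y - x)) + x ^ d * (y - x))
        ≤⟨ +-monoʳ-≤ _ (+-mono-≤ (*-monoʳ-≤ (*-nonNeg (<⇒≤ 0<L) 0≤y-x) y≤b)
             (*-monoʳ-≤ 0≤y-x (^-monoˡ-≤ d 0≤x (≤-trans x≤y y≤b)))) ⟩
      x * x ^ d + (b * (L * (y - x)) + b ^ d * (y - x))
        ≈⟨ solve 5 (λ u b L w z → u :+ (b :* (L :* z) :+ w :* z) := u :+ (b :* L :+ w) :* z)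
             ≈-refl (x * x ^ d) b L (b ^ d) (y - x) ⟩
      x * x ^ d + (b * L + b ^ d) * (y - x)  ∎)

  *-increasing : ∀ {a b f} → 0# ≤ a → Increasing b f → Increasing b (λ x → a * f x)
  *-increasing {a} {f = f} 0≤a (L , 0<L , inc) =
    -- The factor `a` may be zero, as `n C v` is when `v > n`; adding `1#` keeps the constant
    -- positive.
    a * L + 1# , <-≤-trans 0<1 (≤-respʳ-≈ (+-comm _ _) (x≤x+y (*-nonNeg 0≤a (<⇒≤ 0<L)))) , λ {x} {y} 0≤x x≤y y≤b →
    *-monoˡ-≤ 0≤a (proj₁ (inc 0≤x x≤y y≤b)) , (begin
      a * f y                              ≤⟨ *-monoˡ-≤ 0≤a (proj₂ (inc 0≤x x≤y y≤b)) ⟩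
      a * (f x + L * (y - x))              ≤⟨ x≤x+y (x≤y⇒0≤y-x x≤y) ⟩
      a * (f x + L * (y - x)) + (y - x)    ≈⟨ solve 4 (λ a u L z → a :* (u :+ L :* z) :+ z := a :* u :+ (a :* L :+ con ℤ.1ℤ) :* z)
                                                ≈-refl a (f x) L (y - x) ⟩
      a * f x + (a * L + 1#) * (y - x)     ∎)

  Increasing-resp : ∀ {b f g} → (∀ x → f x ≈ g x) → Increasing b f → Increasing b g
  Increasing-resp f≈g (L , 0<L , inc) = L , 0<L , λ 0≤x x≤y y≤b →
    ≤-respˡ-≈ (f≈g _) (≤-respʳ-≈ (f≈g _) (proj₁ (inc 0≤x x≤y y≤b))) ,
    ≤-respˡ-≈ (f≈g _) (≤-respʳ-≈ (+-congʳ (f≈g _)) (proj₂ (inc 0≤x x≤y y≤b)))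

  -- Each existence proof already yields a witness from a point and a proof of membership. Deciding
  -- the order supplies the latter, so the witness becomes a function of the point alone; outside
  -- the interval it takes the arbitrary value `0#`.
  choose : ∀ {p b} {P : Carrier → Carrier → Set p} → (∀ t → t ∈[0, b ] → ∃ (P t)) →
    ∃ λ g → ∀ t → t ∈[0, b ] → P t (g t)
  choose {b = b} {P} h = g , g-spec
    where
    g : Carrier → Carrier
    g t with 0# ≤? t | t ≤? b
    ... | yes 0≤t | yes t≤b = proj₁ (h t (0≤t , t≤b))
    ... | _       | _       = 0#

    g-spec : ∀ t → t ∈[0, b ] → P t (g t)
    g-spec t (0≤t , t≤b) with 0# ≤? t | t ≤? b
    ... | yes 0≤t | yes t≤b = proj₂ (h t (0≤t , t≤b))
    ... | no  0≰t | _       = ⊥-elim (0≰t 0≤t)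
    ... | yes _   | no t≰b  = ⊥-elim (t≰b t≤b)

  module InfimalConvolution {b f g} (f-inc : Increasing b f) (g-inc : Increasing b g) where

    private
      L   = proj₁ f-inc
      0<L = proj₁ (proj₂ f-inc)
      M   = proj₁ g-inc
      0<M = proj₁ (proj₂ g-inc)

      f-bounds : ∀ {x y} → 0# ≤ x → x ≤ y → y ≤ b → f x ≤ f y × f y ≤ f x + L * (y - x)
      f-bounds = proj₂ (proj₂ f-inc)

      g-bounds : ∀ {x y} → 0# ≤ x → x ≤ y → y ≤ b → g x ≤ g y × g y ≤ g x + M * (y - x)
      g-bounds = proj₂ (proj₂ g-inc)

    IsArgmin : Carrier → Carrier → Set (c ⊔ ℓ₂)
    IsArgmin t x = x ∈[0, t ] × (∀ y → y ∈[0, t ] → f x + g (t - x) ≤ f y + g (t - y))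

    -- As `x` grows, `f x` rises with slope at most `L` while `g (t - x)` falls with slope at most
    -- `M`. The sum need not be monotone, which is why minima are established for Lipschitz
    -- functions.
    split-Lipschitz : ∀ {t} → t ≤ b → Lipschitz t (λ x → f x + g (t - x))
    split-Lipschitz {t} t≤b = L + M , <-≤-trans 0<L (x≤x+y (<⇒≤ 0<M)) , λ {x} {y} 0≤x x≤y y≤t →
      let 0≤t-y = x≤y⇒0≤y-x y≤t
          t-y≤t-x = +-monoʳ-≤ t (≤-respˡ-≈ (solve 2 (λ x y → x :- x :- y := :- y) ≈-refl x y)
                      (≤-respʳ-≈ (solve 2 (λ x y → y :- x :- y := :- x) ≈-refl x y)
                        (+-monoˡ-≤ (- y) (+-monoˡ-≤ (- x) x≤y))))
          t-x≤b = ≤-trans (x-y≤x 0≤x) t≤b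
          f-x-y = f-bounds 0≤x x≤y (≤-trans y≤t t≤b)
          g-y-x = g-bounds 0≤t-y t-y≤t-x t-x≤b
          0≤y-x = x≤y⇒0≤y-x x≤y
      in (begin
        f x + g (t - x)
          ≤⟨ +-mono-≤ (proj₁ f-x-y) (proj₂ g-y-x) ⟩
        f y + (g (t - y) + M * (t - x - (t - y)))
          ≈⟨ +-congˡ (+-congˡ (*-congˡ (solve 3 (λ t x y → t :- x :- (t :- y) := y :- x) ≈-refl t x y))) ⟩
        f y + (g (t - y) + M * (y - x))
          ≤⟨ x≤x+y (*-nonNeg (<⇒≤ 0<L) 0≤y-x) ⟩
        f y + (g (t - y) + M * (y - x)) + L * (y - x)
          ≈⟨ solve 5 (λ u v L M z → u :+ (v :+ M :* z) :+ L :* z := u :+ v :+ (L :+ M) :* z)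
               ≈-refl (f y) (g (t - y)) L M (y - x) ⟩
        f y + g (t - y) + (L + M) * (y - x)  ∎) , (begin
        f y + g (t - y)
          ≤⟨ +-mono-≤ (proj₂ f-x-y) (proj₁ g-y-x) ⟩
        f x + L * (y - x) + g (t - x)
          ≤⟨ x≤x+y (*-nonNeg (<⇒≤ 0<M) 0≤y-x) ⟩
        f x + L * (y - x) + g (t - x) + M * (y - x)
          ≈⟨ solve 5 (λ u v L M z → u :+ L :* z :+ v :+ M :* z := u :+ v :+ (L :+ M) :* z)
               ≈-refl (f x) (g (t - x)) L M (y - x) ⟩
        f x + g (t - x) + (L + M) * (y - x)  ∎)

    argmin : ∃ λ x → ∀ t → t ∈[0, b ] → IsArgmin t (x t)
    argmin = choose λ t t∈ → minimum-attained (proj₁ t∈) (split-Lipschitz (proj₂ t∈))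

    module _ (x : Carrier → Carrier) (spec : ∀ t → t ∈[0, b ] → IsArgmin t (x t)) where

      h : Carrier → Carrier
      h t = f (x t) + g (t - x t)

      h-min : ∀ {t y} → 0# ≤ t → t ≤ b → 0# ≤ y → y ≤ t → h t ≤ f y + g (t - y)
      h-min 0≤t t≤b 0≤y y≤t = proj₂ (spec _ (0≤t , t≤b)) _ (0≤y , y≤t)

      -- The minimizer for `u` is truncated to the mass `t`: if it fits, it is kept and `g` receives
      -- less; if not, all of `t` goes to `f`. Both terms can only decrease.
      increasing : ∀ {t u} → 0# ≤ t → t ≤ u → u ≤ b → h t ≤ h u
      increasing {t} {u} 0≤t t≤u u≤b with (0≤xu , xu≤u) , _ ← spec u (≤-trans 0≤t t≤u , u≤b) | ≤-total (x u) t
      ... | inj₁ xu≤t = ≤-trans (h-min 0≤t (≤-trans t≤u u≤b) 0≤xu xu≤t)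
        (+-monoʳ-≤ _ (proj₁ (g-bounds (x≤y⇒0≤y-x xu≤t) (+-monoˡ-≤ _ t≤u) (≤-trans (x-y≤x 0≤xu) u≤b))))
      ... | inj₂ t≤xu = ≤-trans (h-min 0≤t (≤-trans t≤u u≤b) 0≤t ≤-refl)
        (+-mono-≤ (proj₁ (f-bounds 0≤t t≤xu (≤-trans xu≤u u≤b)))
          (proj₁ (g-bounds (x≤y⇒0≤y-x ≤-refl) (≤-respˡ-≈ (≈-sym (-‿inverseʳ t)) (x≤y⇒0≤y-x xu≤u)) (≤-trans (x-y≤x 0≤xu) u≤b))))

      -- The minimizer for `t` is kept and the additional mass `u - t` is given to `g`, hence the
      -- constant `M` of `g`.
      bounded : ∀ {t u} → 0# ≤ t → t ≤ u → u ≤ b → h u ≤ h t + M * (u - t)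
      bounded {t} {u} 0≤t t≤u u≤b with (0≤xt , xt≤t) , _ ← spec t (0≤t , ≤-trans t≤u u≤b) = begin
        h u
          ≤⟨ h-min (≤-trans 0≤t t≤u) u≤b 0≤xt (≤-trans xt≤t t≤u) ⟩
        f (x t) + g (u - x t)
          ≤⟨ +-monoʳ-≤ _ (proj₂ (g-bounds (x≤y⇒0≤y-x xt≤t) (+-monoˡ-≤ _ t≤u) (≤-trans (x-y≤x 0≤xt) u≤b))) ⟩
        f (x t) + (g (t - x t) + M * (u - x t - (t - x t)))
          ≈⟨ +-congˡ (+-congˡ (*-congˡ (solve 3 (λ u t x → u :- x :- (t :- x) := u :- t) ≈-refl u t (x t)))) ⟩
        f (x t) + (g (t - x t) + M * (u - t))
          ≈⟨ +-assoc _ _ _ ⟨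
        h t + M * (u - t)  ∎

      convolution-increasing : Increasing b h
      convolution-increasing = M , 0<M , λ 0≤t t≤u u≤b → increasing 0≤t t≤u u≤b , bounded 0≤t t≤u u≤b

  infimal-convolution : ∀ {b f g} → Increasing b f → Increasing b g →
    ∃ λ x → (∀ t → t ∈[0, b ] → x t ∈[0, t ] ×
              (∀ y → y ∈[0, t ] → f (x t) + g (t - x t) ≤ f y + g (t - y)))
            × Increasing b (λ t → f (x t) + g (t - x t))
  infimal-convolution f-inc g-inc =
    let open InfimalConvolution f-inc g-inc in
    proj₁ argmin , proj₂ argmin , convolution-increasing (proj₁ argmin) (proj₂ argmin)

  if-yes : ∀ {a} {A : Set a} {x y : Carrier} (A? : Dec A) → A → (if does A? then x else y) ≡ x
  if-yes {x = x} {y} A? a = ≡.cong (λ b → if b then x else y) (dec-true A? a)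

  if-no : ∀ {a} {A : Set a} {x y : Carrier} (A? : Dec A) → ¬ A → (if does A? then x else y) ≡ y
  if-no {x = x} {y} A? ¬a = ≡.cong (λ b → if b then x else y) (dec-false A? ¬a)

  module _ {I : Pred (Fin k) s} (I? : Decidable I) where

    sumOver-cong : ∀ {f g} → (∀ i → I i → f i ≈ g i) → sumOver I? f ≈ sumOver I? g
    sumOver-cong {f} {g} f≈g = sum-cong-≋ λ i → term i (I? i)
      where
      term : ∀ i (d : Dec (I i)) → (if does d then f i else 0#) ≈ (if does d then g i else 0#)
      term i (yes Ii) = f≈g i Ii
      term i (no _)   = ≈-refl

    masked-nonNeg : (f : Fin k → Carrier) → (∀ i → I i → 0# ≤ f i) → ∀ i → 0# ≤ (if does (I? i) then f i else 0#)
    masked-nonNeg f 0≤f i with I? i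
    ... | yes Ii = 0≤f i Ii
    ... | no _   = ≤-refl

    sumOver-mono-≤ : ∀ {f g} → (∀ i → I i → f i ≤ g i) → sumOver I? f ≤ sumOver I? g
    sumOver-mono-≤ {f} {g} f≤g = sum-mono-≤ λ i → term i (I? i)
      where
      term : ∀ i (d : Dec (I i)) → (if does d then f i else 0#) ≤ (if does d then g i else 0#)
      term i (yes Ii) = f≤g i Ii
      term i (no _)   = ≤-refl

    term≤sumOver : ∀ {f} → (∀ i → I i → 0# ≤ f i) → ∀ i → I i → f i ≤ sumOver I? f
    term≤sumOver {f} 0≤f i Ii =
      ≤-trans (≤-reflexive (≈-sym (≈-reflexive (if-yes (I? i) Ii)))) (term≤sum (masked-nonNeg f 0≤f) i)

    sumOver-empty : (f : Fin k → Carrier) → (∀ i → ¬ I i) → sumOver I? f ≈ 0#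
    sumOver-empty f ∅ = ≈-trans (sum-cong-≋ (λ i → ≈-reflexive (if-no {x = f i} (I? i) (∅ i))))
      (sum-replicate-zero k)

    sumOver-*ˡ : ∀ a (f : Fin k → Carrier) → sumOver I? (λ i → a * f i) ≈ a * sumOver I? f
    sumOver-*ˡ a f = ≈-trans (sum-cong-≋ λ i → term i (I? i))
      (≈-sym (*-distribˡ-sum a (λ i → if does (I? i) then f i else 0#)))
      where
      term : ∀ i (d : Dec (I i)) → (if does d then a * f i else 0#) ≈ a * (if does d then f i else 0#)
      term i (yes Ii) = ≈-refl
      term i (no _)   = ≈-sym (zeroʳ a)

  module _ {I : Pred (Fin (suc k)) s} (I? : Decidable I) where

    sumOver-suc⁺ : (f : Fin (suc k) → Carrier) → I zero → sumOver I? f ≈ f zero + sumOver (I? ∘ suc) (f ∘ suc)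
    sumOver-suc⁺ f I₀ = +-congʳ (≈-reflexive (if-yes (I? zero) I₀))

    sumOver-suc⁻ : (f : Fin (suc k) → Carrier) → ¬ I zero → sumOver I? f ≈ sumOver (I? ∘ suc) (f ∘ suc)
    sumOver-suc⁻ f ¬I₀ = ≈-trans (+-congʳ (≈-reflexive (if-no (I? zero) ¬I₀))) (+-identityˡ _)

  ScaledSimplex : {I : Pred (Fin k) s} → Decidable I → Carrier → Pred (Fin k → Carrier) (s ⊔ ℓ₁ ⊔ ℓ₂)
  ScaledSimplex {I = I} I? t p = (∀ i → I i → 0# ≤ p i) × sumOver I? p ≈ t

  -- Splitting off one coordinate x leaves the scaled simplex of mass t - x,
  -- so the minimum, as a function of t, is an infimal convolution.

  MinimumFunction : {I : Pred (Fin k) s} → Decidable I → Carrier → (Fin k → Carrier → Carrier) →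
                    (Carrier → Carrier) → Set (c ⊔ ℓ₁ ⊔ ℓ₂ ⊔ s)
  MinimumFunction I? b f μ = Increasing b μ ×
    (∀ t → t ∈[0, b ] → IsMinimum (ScaledSimplex I? t) (λ p → sumOver I? (λ i → f i (p i))) (μ t))

  module _ {b : Carrier} {I : Pred (Fin (suc k)) s} (I? : Decidable I) {f : Fin (suc k) → Carrier → Carrier} where

    MinimumFunction-skip : ¬ I zero → ∃ (MinimumFunction (I? ∘ suc) b (f ∘ suc)) → ∃ (MinimumFunction I? b f)
    MinimumFunction-skip ¬I₀ (μ , μ-inc , μ-min) = μ , μ-inc , λ t t∈ → attained t t∈ , λ p (0≤p , Σp≈t) →
      ≤-respʳ-≈ (≈-sym (sumOver-suc⁻ I? (λ i → f i (p i)) ¬I₀))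
        (proj₂ (μ-min t t∈) (p ∘ suc) (0≤p ∘ suc , ≈-trans (≈-sym (sumOver-suc⁻ I? p ¬I₀)) Σp≈t))
      where
      attained : ∀ t → t ∈[0, b ] → ∃ λ p → ScaledSimplex I? t p × sumOver I? (λ i → f i (p i)) ≈ μ t
      attained t t∈ with (p , (0≤p , Σp≈t) , fp≈μ) ← proj₁ (μ-min t t∈) =
        (0# ◂ p) ,
        ((λ { zero I₀ → ⊥-elim (¬I₀ I₀) ; (suc i) → 0≤p i }) , ≈-trans (sumOver-suc⁻ I? (0# ◂ p) ¬I₀) Σp≈t) ,
        ≈-trans (sumOver-suc⁻ I? (λ i → f i ((0# ◂ p) i)) ¬I₀) fp≈μ

    -- A single coordinate carries the whole mass, so `p zero` can only be `t` up to `≈`, and the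
    -- Lipschitz bound transports `f zero` along this equality.
    MinimumFunction-singleton : I zero → (∀ i → ¬ I (suc i)) → Increasing b (f zero) → MinimumFunction I? b f (f zero)
    MinimumFunction-singleton I₀ ∅ f₀-inc = f₀-inc , λ t t∈ →
      ( (λ _ → t) , ((λ _ _ → proj₁ t∈) , single (λ _ → t)) , single (λ i → f i t)) ,
      λ p (0≤p , Σp≈t) →
        let t≈p₀ = ≈-trans (≈-sym Σp≈t) (single p) in
        ≤-reflexive (≈-trans
          (Lipschitz⇒cong (Increasing⇒Lipschitz f₀-inc) t∈ (≤-respˡ-≈ t≈p₀ (proj₂ t∈)) t≈p₀)
          (≈-sym (single (λ i → f i (p i)))))
      where
      single : ∀ g → sumOver I? g ≈ g zero
      single g = ≈-trans (sumOver-suc⁺ I? g I₀)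
        (≈-trans (+-congˡ (sumOver-empty (I? ∘ suc) (g ∘ suc) ∅)) (+-identityʳ _))

    MinimumFunction-extend : I zero → ∀ {μ} → MinimumFunction (I? ∘ suc) b (f ∘ suc) μ →
      (x : Carrier → Carrier) → (∀ t → t ∈[0, b ] → x t ∈[0, t ] ×
              (∀ y → y ∈[0, t ] → f zero (x t) + μ (t - x t) ≤ f zero y + μ (t - y))) →
      Increasing b (λ t → f zero (x t) + μ (t - x t)) →
      MinimumFunction I? b f (λ t → f zero (x t) + μ (t - x t))
    MinimumFunction-extend I₀ {μ} (μ-inc , μ-min) x x-min h-inc =
      h-inc , λ t t∈ → attained t t∈ , λ p p∈ → minimal t t∈ p p∈
      where
      rest : ∀ {t x} → t ∈[0, b ] → x ∈[0, t ] → t - x ∈[0, b ]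
      rest (_ , t≤b) (0≤x , x≤t) = x≤y⇒0≤y-x x≤t , ≤-trans (x-y≤x 0≤x) t≤b

      attained : ∀ t → t ∈[0, b ] → ∃ λ p → ScaledSimplex I? t p ×
        sumOver I? (λ i → f i (p i)) ≈ f zero (x t) + μ (t - x t)
      attained t t∈
        with x∈ , _ ← x-min t t∈
        with (p , (0≤p , Σp≈) , fp≈μ) ← proj₁ (μ-min (t - x t) (rest t∈ x∈)) =
        (x t ◂ p) ,
        ( (λ { zero _ → proj₁ x∈ ; (suc i) → 0≤p i })
        , ≈-trans (sumOver-suc⁺ I? (x t ◂ p) I₀) (≈-trans (+-congˡ Σp≈) (a+[b-a]≈b (x t) t))) ,
        ≈-trans (sumOver-suc⁺ I? (λ i → f i ((x t ◂ p) i)) I₀) (+-congˡ fp≈μ)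

      minimal : ∀ t → t ∈[0, b ] → ∀ p → ScaledSimplex I? t p →
        f zero (x t) + μ (t - x t) ≤ sumOver I? (λ i → f i (p i))
      minimal t t∈ p (0≤p , Σp≈t) = begin
        f zero (x t) + μ (t - x t)
          ≤⟨ proj₂ (x-min t t∈) (p zero) p₀∈ ⟩
        f zero (p zero) + μ (t - p zero)
          ≤⟨ +-monoʳ-≤ _ (proj₂ (μ-min (t - p zero) (rest t∈ p₀∈)) (p ∘ suc) (0≤p ∘ suc , Σp′≈)) ⟩
        f zero (p zero) + sumOver (I? ∘ suc) (λ i → f (suc i) (p (suc i)))
          ≈⟨ sumOver-suc⁺ I? (λ i → f i (p i)) I₀ ⟨
        sumOver I? (λ i → f i (p i)) ∎
        where
        p₀∈ : p zero ∈[0, t ]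
        p₀∈ = 0≤p zero I₀ , ≤-respʳ-≈ Σp≈t (term≤sumOver I? 0≤p zero I₀)

        Σp′≈ : sumOver (I? ∘ suc) (p ∘ suc) ≈ t - p zero
        Σp′≈ = begin-equality
          sumOver (I? ∘ suc) (p ∘ suc)
            ≈⟨ solve 2 (λ a b → b := a :+ b :- a) ≈-refl (p zero) (sumOver (I? ∘ suc) (p ∘ suc)) ⟩
          p zero + sumOver (I? ∘ suc) (p ∘ suc) - p zero
            ≈⟨ +-congʳ (≈-trans (≈-sym (sumOver-suc⁺ I? p I₀)) Σp≈t) ⟩
          t - p zero  ∎

  -- The recursion ends with one member of `I` left rather than none: over an empty index set there
  -- is no point of positive mass, hence no minimum to start from.
  minimumFunction : ∀ {k b} {I : Pred (Fin k) s} (I? : Decidable I) {f : Fin k → Carrier → Carrier} →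
    (∀ i → Increasing b (f i)) → ∃ I → ∃ (MinimumFunction I? b f)
  minimumFunction {k = suc k} {b} {I} I? {f} f-inc ∃I = by-cases (I? zero) (Fin.any? (I? ∘ suc))
    where
    by-cases : Dec (I zero) → Dec (∃ (I ∘ suc)) → ∃ (MinimumFunction I? b f)
    by-cases (no ¬I₀) (no ∅)    = ⊥-elim (empty ∃I)
      where
      empty : ¬ ∃ I
      empty (zero  , I₀) = ¬I₀ I₀
      empty (suc i , Ii) = ∅ (i , Ii)
    by-cases (no ¬I₀) (yes ∃I′) = MinimumFunction-skip I? {f} ¬I₀ (minimumFunction (I? ∘ suc) {f ∘ suc} (f-inc ∘ suc) ∃I′)
    by-cases (yes I₀) (no ∅)    = _ , MinimumFunction-singleton I? {f} I₀ (λ i Ii → ∅ (i , Ii)) (f-inc zero)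
    by-cases (yes I₀) (yes ∃I′) =
      let μ , μ-min = minimumFunction (I? ∘ suc) {f ∘ suc} (f-inc ∘ suc) ∃I′
          x , x-min , h-inc = infimal-convolution (f-inc zero) (proj₁ μ-min)
      in _ , MinimumFunction-extend I? {f} I₀ μ-min x x-min h-inc

  simplex-minimum : ∀ {k} {I : Pred (Fin k) s} (I? : Decidable I) {f : Fin k → Carrier → Carrier} →
    (∀ i → Increasing 1# (f i)) → ∃ I →
    ∃ λ μ → IsMinimum (Simplex I?) (λ p → sumOver I? (λ i → f i (p i))) μ
  simplex-minimum I? {f} f-inc ∃I with μ , _ , μ-min ← minimumFunction I? {f} f-inc ∃I =
    μ 1# , μ-min 1# (0≤1 , ≤-refl)

  root : ∀ {d x} → 1 ℕ.≤ d → 0# ≤ x → ∃ (IsRoot d x)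
  root {suc d} {x} 1≤d 0≤x =
    let r , (0≤r , _) , r^d≈x = intermediate-value {f = _^ suc d} (<⇒≤ 0<b)
          (Increasing⇒Lipschitz (^-increasing 0<b (suc d))) (≤-respˡ-≈ (≈-sym (0^n≈0 1≤d)) 0≤x) x≤b^d
    in r , 0≤r , r^d≈x
    where
    -- Since `b ≥ 1#`, its powers with positive exponent are at least `b`, hence at least `x`,
    -- whether or not `x` exceeds `1#`.
    b = 1# + x

    0<b : 0# < b
    0<b = <-≤-trans 0<1 (x≤x+y 0≤x)

    1≤b^ : ∀ n → 1# ≤ b ^ n
    1≤b^ zero    = ≤-refl
    1≤b^ (suc n) = begin
      1#         ≤⟨ x≤x+y 0≤x ⟩
      b          ≈⟨ *-identityʳ b ⟨
      b * 1#     ≤⟨ *-monoˡ-≤ (<⇒≤ 0<b) (1≤b^ n) ⟩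
      b * b ^ n  ∎

    x≤b^d : x ≤ b ^ suc d
    x≤b^d = begin
      x          ≤⟨ x≤x+y 0≤1 ⟩
      x + 1#     ≈⟨ +-comm x 1# ⟩
      b          ≈⟨ *-identityʳ b ⟨
      b * 1#     ≤⟨ *-monoˡ-≤ (<⇒≤ 0<b) (1≤b^ d) ⟩
      b * b ^ d  ∎

-- Counting strictly monotone maps.

lookup-injective : ∀ {a} {A : Set a} {xs : List A} → Unique xs → ∀ i j → lookup xs i ≡ lookup xs j → i ≡ j
lookup-injective (_ ∷ _)     zero    zero    _  = ≡.refl
lookup-injective (x∉ ∷ _)    zero    (suc j) eq = ⊥-elim (All.lookup x∉ (∈-lookup j) eq)
lookup-injective (x∉ ∷ _)    (suc i) zero    eq = ⊥-elim (All.lookup x∉ (∈-lookup i) (≡.sym eq))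
lookup-injective (_ ∷ uniq)  (suc i) (suc j) eq = ≡.cong suc (lookup-injective uniq i j eq)

-- Sending a position in `xs` to the position of the same element in `ys` is an injection between
-- finite types.
Unique-⊆⇒length≤ : ∀ {a} {A : Set a} {xs ys : List A} → Unique xs → xs ⊆ ys → length xs ℕ.≤ length ys
Unique-⊆⇒length≤ {xs = xs} {ys} uniq xs⊆ys = Fin.injective⇒≤ {f = λ i → index (xs⊆ys (∈-lookup i))} λ {i} {j} eq →
  lookup-injective uniq i j (index-injective (≡.setoid _) (xs⊆ys (∈-lookup i)) (xs⊆ys (∈-lookup j)) eq)

length-filter-map : ∀ {a b p} {A : Set a} {B : Set b} {P : Pred B p} (P? : Decidable P) (f : A → B) xs →
  length (filter P? (map f xs)) ≡ length (filter (P? ∘ f) xs)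
length-filter-map P? f []       = ≡.refl
length-filter-map P? f (x ∷ xs) with P? (f x)
... | yes _ = ≡.cong suc (length-filter-map P? f xs)
... | no  _ = length-filter-map P? f xs

StrictlyMonotone : Pred (Fin m → Fin n) _
StrictlyMonotone φ = ∀ x y → x Fin.< y → φ x Fin.< φ y

strictlyMonotone? : Decidable (StrictlyMonotone {m} {n})
strictlyMonotone? φ = Fin.all? λ x → Fin.all? λ y → x Fin.<? y →-dec φ x Fin.<? φ y

StrictlyMonotone⇒injective : {φ : Fin m → Fin n} → StrictlyMonotone φ → ∀ {x y} → φ x ≡ φ y → x ≡ y
StrictlyMonotone⇒injective mono {x} {y} eq with Fin.<-cmp x y
... | tri< x<y _ _ = ⊥-elim (Fin.<-irrefl eq (mono x y x<y))
... | tri≈ _ x≡y _ = x≡y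
... | tri> _ _ y<x = ⊥-elim (Fin.<-irrefl (≡.sym eq) (mono y x y<x))

-- The recursion is Pascal's rule: a strictly monotone map either takes the value `zero`,
-- necessarily at `zero`, or has only positive values.
strictlyMonotones : ∀ m n → List (Fin m → Fin n)
strictlyMonotones zero    n       = (λ ()) ∷ []
strictlyMonotones (suc m) zero    = []
strictlyMonotones (suc m) (suc n) =
  map (λ φ → zero ◂ suc ∘ φ) (strictlyMonotones m n) ++ map (suc ∘_) (strictlyMonotones (suc m) n)

length-strictlyMonotones : ∀ m n → length (strictlyMonotones m n) ≡ n C m
length-strictlyMonotones zero    n       = ≡.sym (≡.trans (nCk≡nC[n∸k] {n = n} ℕ.z≤n) (nCn≡1 n))
length-strictlyMonotones (suc m) zero    = ≡.sym (k>n⇒nCk≡0 {0} {suc m} ℕ.z<s)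
length-strictlyMonotones (suc m) (suc n) = begin
  length (map _ (strictlyMonotones m n) ++ map _ (strictlyMonotones (suc m) n))
    ≡⟨ length-++ (map _ (strictlyMonotones m n)) ⟩
  length (map _ (strictlyMonotones m n)) ℕ.+ length (map _ (strictlyMonotones (suc m) n))
    ≡⟨ ≡.cong₂ ℕ._+_ (length-map _ (strictlyMonotones m n)) (length-map _ (strictlyMonotones (suc m) n)) ⟩
  length (strictlyMonotones m n) ℕ.+ length (strictlyMonotones (suc m) n)
    ≡⟨ ≡.cong₂ ℕ._+_ (length-strictlyMonotones m n) (length-strictlyMonotones (suc m) n) ⟩
  n C m ℕ.+ n C suc m
    ≡⟨ nCk+nC[k+1]≡[n+1]C[k+1] n m ⟩
  suc n C suc m ∎
  where open ≡.≡-Reasoning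

positive⇒suc : (φ : Fin m → Fin (suc n)) → (∀ x → zero {n} Fin.< φ x) → ∃ λ (ψ : Fin m → Fin n) → φ ≗ suc ∘ ψ
positive⇒suc φ 0<φ = (λ x → proj₁ (pred (φ x) (0<φ x))) , λ x → proj₂ (pred (φ x) (0<φ x))
  where
  pred : ∀ {n} (i : Fin (suc n)) → zero {n} Fin.< i → ∃ λ j → i ≡ suc j
  pred (suc i) _ = i , ≡.refl

∈-strictlyMonotones : ∀ m n {φ : Fin m → Fin n} → StrictlyMonotone φ → ∃ λ ψ → ψ ∈ strictlyMonotones m n × φ ≗ ψ
∈-strictlyMonotones zero    n       mono = _ , here ≡.refl , λ ()
∈-strictlyMonotones (suc m) zero    {φ} mono with () ← φ zero
∈-strictlyMonotones (suc m) (suc n) {φ} mono with φ zero in φ0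
... | zero
  with ψ , φ≗ ← positive⇒suc (φ ∘ suc)
    (λ x → ≡.subst (Fin._< φ (suc x)) φ0 (mono zero (suc x) (ℕ.s≤s ℕ.z≤n)))
  with ψ′ , ψ′∈ , ψ≗ψ′ ← ∈-strictlyMonotones m n {ψ}
    (λ x y x<y → ℕ.s<s⁻¹ (≡.subst₂ Fin._<_ (φ≗ x) (φ≗ y) (mono (suc x) (suc y) (ℕ.s≤s x<y))))
  = _ , ∈-++⁺ˡ (∈-map⁺ _ ψ′∈) , λ { zero → φ0 ; (suc x) → ≡.trans (φ≗ x) (≡.cong suc (ψ≗ψ′ x)) }
∈-strictlyMonotones (suc m) (suc n) {φ} mono | suc i
  with ψ , φ≗ ← positive⇒suc φ (λ { zero → ≡.subst (zero {n} Fin.<_) (≡.sym φ0) (ℕ.s≤s ℕ.z≤n)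
                                  ; (suc x) → ℕ.≤-<-trans ℕ.z≤n (mono zero (suc x) (ℕ.s≤s ℕ.z≤n)) })
  with ψ′ , ψ′∈ , ψ≗ψ′ ← ∈-strictlyMonotones (suc m) n {ψ}
    (λ x y x<y → ℕ.s<s⁻¹ (≡.subst₂ Fin._<_ (φ≗ x) (φ≗ y) (mono x y x<y)))
  = _ , ∈-++⁺ʳ _ (∈-map⁺ _ ψ′∈) , λ x → ≡.trans (φ≗ x) (≡.cong suc (ψ≗ψ′ x))

funToFin-cong : ∀ m {n} {φ ψ : Fin m → Fin n} → φ ≗ ψ → funToFin φ ≡ funToFin ψ
funToFin-cong zero    φ≗ψ = ≡.refl
funToFin-cong (suc m) φ≗ψ = ≡.cong₂ combine (φ≗ψ zero) (funToFin-cong m (φ≗ψ ∘ suc))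

-- Maps are compared through their codes in `Fin (n ^ m)`, where pointwise equal functions become
-- equal. The codes being filtered are distinct and all occur among the codes of the `n C m` listed
-- maps.
#strictlyMonotone≤C : ∀ m n → length (filter strictlyMonotone? (functions m n)) ℕ.≤ n C m
#strictlyMonotone≤C m n = begin
  length (filter strictlyMonotone? (functions m n))
    ≡⟨ length-filter-map strictlyMonotone? decode (allFin (n ℕ.^ m)) ⟩
  length (filter (strictlyMonotone? ∘ decode) (allFin (n ℕ.^ m)))
    ≤⟨ Unique-⊆⇒length≤ (Unique.filter⁺ _ (Unique.allFin⁺ _)) codes⊆ ⟩
  length (map funToFin (strictlyMonotones m n))
    ≡⟨ length-map funToFin (strictlyMonotones m n) ⟩
  length (strictlyMonotones m n)
    ≡⟨ length-strictlyMonotones m n ⟩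
  n C m ∎
  where
  open ℕ.≤-Reasoning

  decode : Fin (n ℕ.^ m) → Fin m → Fin n
  decode = finToFun

  codes⊆ : filter (strictlyMonotone? ∘ decode) (allFin (n ℕ.^ m)) ⊆ map funToFin (strictlyMonotones m n)
  codes⊆ {a} a∈
    with ψ , ψ∈ , eq ← ∈-strictlyMonotones m n
      (proj₂ (∈-filter⁻ (strictlyMonotone? ∘ decode) {xs = allFin _} a∈)) =
    ≡.subst (_∈ map funToFin (strictlyMonotones m n))
      (≡.trans (funToFin-cong m (≡.sym ∘ eq)) (Fin.funToFin-finToFin {m} a)) (∈-map⁺ funToFin ψ∈)

-- Positions of a coloring occupied by the edges of a graph.

module _ (G : OrderedGraph) where
  open OrderedGraph G

  edges : List (Fin v × Fin v)
  edges = filter (λ (x , y) → x Fin.<? y ×-dec x ~? y) (cartesianProduct (allFin v) (allFin v))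

  cells : (Fin v → Fin n) → List (Fin (n ℕ.* n))
  cells φ = map (λ (x , y) → combine (φ x) (φ y)) edges

  length-cells : (φ : Fin v → Fin n) → length (cells φ) ≡ e G
  length-cells φ = length-map _ edges

  -- Distinct edges occupy distinct, hence independent, coordinates of a random coloring; this is
  -- what makes the exponent `e G`.
  cells-unique : {φ : Fin v → Fin n} → StrictlyMonotone φ → Unique (cells φ)
  cells-unique {φ = φ} mono = Unique.map⁺ inj
    (Unique.filter⁺ _ (Unique.cartesianProduct⁺ (Unique.allFin⁺ _) (Unique.allFin⁺ _)))
    where
    inj : ∀ {a b} → combine (φ (proj₁ a)) (φ (proj₂ a)) ≡ combine (φ (proj₁ b)) (φ (proj₂ b)) → a ≡ b
    inj {x , y} {x′ , y′} eq with φx≡ , φy≡ ← Fin.combine-injective (φ x) (φ y) (φ x′) (φ y′) eq =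
      ≡.cong₂ _,_ (StrictlyMonotone⇒injective mono φx≡) (StrictlyMonotone⇒injective mono φy≡)

-- Expected counts under a random coloring.

module RandomColoring {c ℓ₁ ℓ₂} (R : CompleteOrderedField c ℓ₁ ℓ₂) where

  open OrderedField R
  open SimplexMinimum R using (if-yes; if-no)
  open Multiplicity R
  open ≤-Reasoning

  [_] : ∀ {a} {A : Set a} → Dec A → Carrier
  [ A? ] = if does A? then 1# else 0#

  [_]-nonNeg : ∀ {a} {A : Set a} (A? : Dec A) → 0# ≤ [ A? ]
  [ yes _ ]-nonNeg = 0≤1
  [ no _  ]-nonNeg = ≤-refl

  fromℕ-length-filter : ∀ {a p} {A : Set a} {P : Pred A p} (P? : Decidable P) x xs →
    fromℕ (length (filter P? (x ∷ xs))) ≈ [ P? x ] + fromℕ (length (filter P? xs))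
  fromℕ-length-filter P? x xs with P? x
  ... | yes _ = ≈-refl
  ... | no  _ = ≈-sym (+-identityˡ _)

  sum-δ : ∀ {m} (q : Fin m → Carrier) i → sum (λ j → q j * [ j Fin.≟ i ]) ≈ q i
  sum-δ {suc m} q zero = begin-equality
    q zero * 1# + sum (λ j → q (suc j) * 0#)  ≈⟨ +-cong (*-identityʳ _) (sum-cong-≋ λ j → zeroʳ (q (suc j))) ⟩
    q zero + sum (λ (_ : Fin m) → 0#)         ≈⟨ +-congˡ (sum-replicate-zero m) ⟩
    q zero + 0#                               ≈⟨ +-identityʳ _ ⟩
    q zero                                    ∎
  sum-δ {suc m} q (suc i) = begin-equality
    q zero * 0# + sum (λ j → q (suc j) * [ suc j Fin.≟ suc i ])
      ≈⟨ +-cong (zeroʳ _) (sum-cong-≋ λ j → *-congˡ (≈-reflexive (suc-≟ j))) ⟩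
    0# + sum (λ j → q (suc j) * [ j Fin.≟ i ])
      ≈⟨ +-identityˡ _ ⟩
    sum (λ j → q (suc j) * [ j Fin.≟ i ])
      ≈⟨ sum-δ (q ∘ suc) i ⟩
    q (suc i) ∎
    where
    suc-≟ : ∀ j → [ suc j Fin.≟ suc i ] ≡ [ j Fin.≟ i ]
    suc-≟ j = ≡.refl

  ∏ : (Fin n → Carrier) → Carrier
  ∏ = Vector.foldr _*_ 1#

  ∏-nonNeg : {f : Fin n → Carrier} → (∀ i → 0# ≤ f i) → 0# ≤ ∏ f
  ∏-nonNeg {zero}  0≤f = 0≤1
  ∏-nonNeg {suc n} 0≤f = *-nonNeg (0≤f zero) (∏-nonNeg (0≤f ∘ suc))

  ∏-cong : {f g : Fin n → Carrier} → (∀ i → f i ≈ g i) → ∏ f ≈ ∏ g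
  ∏-cong {zero}  f≈g = ≈-refl
  ∏-cong {suc n} f≈g = *-cong (f≈g zero) (∏-cong (f≈g ∘ suc))

  ∏-1 : {f : Fin n → Carrier} → (∀ i → f i ≈ 1#) → ∏ f ≈ 1#
  ∏-1 {zero}  f≈1 = ≈-refl
  ∏-1 {suc n} f≈1 = ≈-trans (*-cong (f≈1 zero) (∏-1 (f≈1 ∘ suc))) (*-identityˡ 1#)

  -- The form with `tabulate f` lets the induction move on to `f ∘ suc`; `allFin n` is the case of
  -- the identity.
  ∏-if : ∀ {a p} {A : Set a} {P : Pred A p} (P? : Decidable P) x (f : Fin n → A) →
    ∏ (λ i → if does (P? (f i)) then x else 1#) ≈ x ^ length (filter P? (tabulate f))
  ∏-if {n = zero}  P? x f = ≈-refl
  ∏-if {n = suc n} P? x f with P? (f zero)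
  ... | yes _ = *-congˡ (∏-if P? x (f ∘ suc))
  ... | no  _ = ≈-trans (*-identityˡ _) (∏-if P? x (f ∘ suc))

  module Expectation (p : Fin k → Carrier) (0≤p : ∀ i → 0# ≤ p i) (Σp≈1 : sum p ≈ 1#) where

    -- The coordinates are independent, each with distribution p.
    𝔼 : ∀ n → ((Fin n → Fin k) → Carrier) → Carrier
    𝔼 zero    F = F (λ ())
    𝔼 (suc n) F = sum λ i → p i * 𝔼 n (λ f → F (i ◂ f))

    𝔼-mono-≤ : ∀ n {F G} → (∀ f → F f ≤ G f) → 𝔼 n F ≤ 𝔼 n G
    𝔼-mono-≤ zero    F≤G = F≤G _
    𝔼-mono-≤ (suc n) F≤G = sum-mono-≤ λ i → *-monoˡ-≤ (0≤p i) (𝔼-mono-≤ n (λ f → F≤G (i ◂ f)))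

    𝔼-cong : ∀ n {F G} → (∀ f → F f ≈ G f) → 𝔼 n F ≈ 𝔼 n G
    𝔼-cong n F≈G = antisym (𝔼-mono-≤ n (≤-reflexive ∘ F≈G)) (𝔼-mono-≤ n (≤-reflexive ∘ ≈-sym ∘ F≈G))

    𝔼-+ : ∀ n F G → 𝔼 n (λ f → F f + G f) ≈ 𝔼 n F + 𝔼 n G
    𝔼-+ zero    F G = ≈-refl
    𝔼-+ (suc n) F G = ≈-trans
      (sum-cong-≋ λ i → ≈-trans (*-congˡ (𝔼-+ n (F ∘ (i ◂_)) (G ∘ (i ◂_)))) (distribˡ (p i) _ _))
      (∑-distrib-+ (λ i → p i * 𝔼 n (F ∘ (i ◂_))) (λ i → p i * 𝔼 n (G ∘ (i ◂_))))

    𝔼-* : ∀ n a F → 𝔼 n (λ f → a * F f) ≈ a * 𝔼 n F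
    𝔼-* zero    a F = ≈-refl
    𝔼-* (suc n) a F = ≈-trans
      (sum-cong-≋ λ i → ≈-trans (*-congˡ (𝔼-* n a (F ∘ (i ◂_))))
        (solve 3 (λ p a x → p :* (a :* x) := a :* (p :* x)) ≈-refl (p i) a (𝔼 n (F ∘ (i ◂_)))))
      (≈-sym (*-distribˡ-sum a (λ i → p i * 𝔼 n (F ∘ (i ◂_)))))

    𝔼-const : ∀ n a → 𝔼 n (λ _ → a) ≈ a
    𝔼-const zero    a = ≈-refl
    𝔼-const (suc n) a = begin-equality
      (sum λ i → p i * 𝔼 n (λ _ → a))  ≈⟨ sum-cong-≋ {k} (λ i → *-congˡ {p i} (𝔼-const n a)) ⟩
      (sum λ i → p i * a)               ≈⟨ *-distribʳ-sum a p ⟨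
      sum p * a                         ≈⟨ *-congʳ Σp≈1 ⟩
      1# * a                            ≈⟨ *-identityˡ a ⟩
      a                                 ∎

    𝔼-sum : ∀ n {m} (F : Fin m → (Fin n → Fin k) → Carrier) →
      𝔼 n (λ f → sum (λ i → F i f)) ≈ sum (λ i → 𝔼 n (F i))
    𝔼-sum n {zero}  F = 𝔼-const n 0#
    𝔼-sum n {suc m} F = ≈-trans (𝔼-+ n (F zero) _) (+-congˡ (𝔼-sum n (F ∘ suc)))

    -- Independence: once the first coordinate is fixed, its factor leaves the inner expectation,
    -- and what remains does not depend on it.
    𝔼-∏ : ∀ n (g : Fin n → Fin k → Carrier) →
      𝔼 n (λ f → ∏ (λ x → g x (f x))) ≈ ∏ (λ x → sum (λ i → p i * g x i))
    𝔼-∏ zero    g = ≈-refl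
    𝔼-∏ (suc n) g = begin-equality
      (sum λ i → p i * 𝔼 n (λ f → g zero i * ∏ (λ x → g (suc x) (f x))))
        ≈⟨ sum-cong-≋ (λ i → ≈-trans (*-congˡ (𝔼-* n (g zero i) _)) (≈-sym (*-assoc _ _ _))) ⟩
      (sum λ i → p i * g zero i * 𝔼 n (λ f → ∏ (λ x → g (suc x) (f x))))
        ≈⟨ *-distribʳ-sum _ (λ i → p i * g zero i) ⟨
      (sum λ i → p i * g zero i) * 𝔼 n (λ f → ∏ (λ x → g (suc x) (f x)))
        ≈⟨ *-congˡ (𝔼-∏ n (g ∘ suc)) ⟩
      (sum λ i → p i * g zero i) * ∏ (λ x → sum (λ i → p i * g (suc x) i)) ∎

    p≤1 : ∀ i → p i ≤ 1#
    p≤1 i = ≤-respʳ-≈ Σp≈1 (term≤sum 0≤p i)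

    -- A coordinate in `S` contributes the probability `p i`; any other contributes the total mass
    -- 1.
    𝔼-monochromatic : ∀ n {q} {S : Pred (Fin n) q} (S? : Decidable S) i →
      𝔼 n (λ f → ∏ (λ x → if does (S? x) then [ f x Fin.≟ i ] else 1#)) ≈ p i ^ length (filter S? (allFin n))
    𝔼-monochromatic n S? i = begin-equality
      𝔼 n (λ f → ∏ (λ x → if does (S? x) then [ f x Fin.≟ i ] else 1#))
        ≈⟨ 𝔼-∏ n (λ x j → if does (S? x) then [ j Fin.≟ i ] else 1#) ⟩
      ∏ (λ x → sum (λ j → p j * (if does (S? x) then [ j Fin.≟ i ] else 1#)))
        ≈⟨ ∏-cong (λ x → factor (S? x)) ⟩
      ∏ (λ x → if does (S? x) then p i else 1#)
        ≈⟨ ∏-if S? (p i) (λ x → x) ⟩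
      p i ^ length (filter S? (allFin n)) ∎
      where
      factor : ∀ {a} {A : Set a} (A? : Dec A) →
        sum (λ j → p j * (if does A? then [ j Fin.≟ i ] else 1#)) ≈ (if does A? then p i else 1#)
      factor (yes _) = sum-δ p i
      factor (no _)  = ≈-trans (sum-cong-≋ λ j → *-identityʳ (p j)) Σp≈1

    decode : (Fin (n ℕ.* n) → Fin k) → Coloring n k
    decode f x y = f (combine x y)

    module _ (i : Fin k) (G : OrderedGraph) where
      open OrderedGraph G using (v; _~?_)

      𝔼-copy : (φ : Fin v → Fin n) →
        𝔼 (n ℕ.* n) (λ f → [ isCopy? (decode f) i G φ ]) ≤ [ strictlyMonotone? φ ] * p i ^ e G
      𝔼-copy {n} φ = by-cases (strictlyMonotone? φ)
        where
        by-cases : (mono? : Dec (StrictlyMonotone φ)) →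
          𝔼 (n ℕ.* n) (λ f → [ isCopy? (decode f) i G φ ]) ≤ [ mono? ] * p i ^ e G
        by-cases (no ¬mono) = begin
          𝔼 (n ℕ.* n) (λ f → [ isCopy? (decode f) i G φ ])
            ≤⟨ 𝔼-mono-≤ (n ℕ.* n) (λ f → ≤-reflexive (≈-reflexive (if-no (isCopy? (decode f) i G φ)
                 (λ copy → ¬mono (λ x y x<y → proj₁ (copy x y x<y)))))) ⟩
          𝔼 (n ℕ.* n) (λ _ → 0#)  ≈⟨ 𝔼-const (n ℕ.* n) 0# ⟩
          0#                      ≈⟨ zeroˡ _ ⟨
          0# * p i ^ e G          ∎
        by-cases (yes mono) = begin
          𝔼 (n ℕ.* n) (λ f → [ isCopy? (decode f) i G φ ])
            ≤⟨ 𝔼-mono-≤ (n ℕ.* n) copy≤∏ ⟩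
          𝔼 (n ℕ.* n) (λ f → ∏ (λ x → if does (cell? x) then [ f x Fin.≟ i ] else 1#))
            ≈⟨ 𝔼-monochromatic (n ℕ.* n) cell? i ⟩
          p i ^ length (filter cell? (allFin (n ℕ.* n)))
            -- At least `e G` positions are constrained, and `p i` is at most 1, so lowering the
            -- exponent to `e G` only enlarges the power.
            ≤⟨ ^-antimonoʳ-≤ (0≤p i) (p≤1 i) e≤ ⟩
          p i ^ e G       ≈⟨ *-identityˡ _ ⟨
          1# * p i ^ e G  ∎
          where
          cell? : Decidable (_∈ cells G φ)
          cell? x = member? Fin._≟_ x (cells G φ)

          e≤ : e G ℕ.≤ length (filter cell? (allFin (n ℕ.* n)))
          e≤ = ≡.subst (ℕ._≤ length (filter cell? (allFin (n ℕ.* n)))) (length-cells G φ)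
            (Unique-⊆⇒length≤ (cells-unique G mono) (λ {x} x∈ → ∈-filter⁺ cell? (∈-allFin x) x∈))

          copy≤∏ : ∀ f → [ isCopy? (decode f) i G φ ] ≤ ∏ (λ x → if does (cell? x) then [ f x Fin.≟ i ] else 1#)
          copy≤∏ f = bound (isCopy? (decode f) i G φ)
            where
            bound : (copy? : Dec (IsCopy (decode f) i G φ)) →
              [ copy? ] ≤ ∏ (λ x → if does (cell? x) then [ f x Fin.≟ i ] else 1#)
            bound (no _) = ∏-nonNeg λ x → nonNeg x (cell? x)
              where
              nonNeg : ∀ x {a} {A : Set a} (A? : Dec A) → 0# ≤ (if does A? then [ f x Fin.≟ i ] else 1#)
              nonNeg x (yes _) = [ f x Fin.≟ i ]-nonNeg
              nonNeg x (no _)  = 0≤1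
            bound (yes copy) = ≤-reflexive (≈-sym (∏-1 λ x → one x (cell? x)))
              where
              one : ∀ x (x∈? : Dec (x ∈ cells G φ)) → (if does x∈? then [ f x Fin.≟ i ] else 1#) ≈ 1#
              one x (no _)   = ≈-refl
              -- A constrained position comes from an edge with endpoints `a < b`, which the copy
              -- forces to have color `i`.
              one x (yes x∈) with (a , b) , ab∈ , ≡.refl ← ∈-map⁻ _ x∈
                with _ , (a<b , a~b) ← ∈-filter⁻ _ {xs = List.cartesianProduct (allFin v) (allFin v)} ab∈ =
                ≈-reflexive (if-yes (f _ Fin.≟ i) (proj₂ (copy a b a<b) a~b))

      -- Linearity of expectation over all candidate maps. The induction runs over an arbitrary list
      -- of maps, with `functions v n` substituted at the end.
      𝔼-N : ∀ n → 𝔼 (n ℕ.* n) (λ f → fromℕ (N {n} (decode f) i G)) ≤ p i ^ e G * fromℕ (n C v)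
      𝔼-N n = begin
        𝔼 (n ℕ.* n) (λ f → fromℕ (N {n} (decode f) i G))
          ≤⟨ bound (functions v n) ⟩
        p i ^ e G * fromℕ (length (filter strictlyMonotone? (functions v n)))
          ≤⟨ *-monoˡ-≤ (^-nonNeg (e G) (0≤p i)) (fromℕ-mono-≤ (#strictlyMonotone≤C v n)) ⟩
        p i ^ e G * fromℕ (n C v) ∎
        where
        bound : ∀ φs → 𝔼 (n ℕ.* n) (λ f → fromℕ (length (filter (isCopy? {n} (decode f) i G) φs))) ≤
                       p i ^ e G * fromℕ (length (filter strictlyMonotone? φs))
        bound []       = ≤-reflexive (≈-trans (𝔼-const (n ℕ.* n) 0#) (≈-sym (zeroʳ _)))
        bound (φ ∷ φs) = begin
          𝔼 (n ℕ.* n) (λ f → fromℕ (length (filter (isCopy? (decode f) i G) (φ ∷ φs))))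
            ≈⟨ 𝔼-cong (n ℕ.* n) (λ f → fromℕ-length-filter (isCopy? (decode f) i G) φ φs) ⟩
          𝔼 (n ℕ.* n) (λ f → [ isCopy? (decode f) i G φ ] + fromℕ (length (filter (isCopy? (decode f) i G) φs)))
            ≈⟨ 𝔼-+ (n ℕ.* n) _ _ ⟩
          𝔼 (n ℕ.* n) (λ f → [ isCopy? (decode f) i G φ ]) +
            𝔼 (n ℕ.* n) (λ f → fromℕ (length (filter (isCopy? (decode f) i G) φs)))
            ≤⟨ +-mono-≤ (𝔼-copy φ) (bound φs) ⟩
          [ strictlyMonotone? φ ] * p i ^ e G + p i ^ e G * fromℕ (length (filter strictlyMonotone? φs))
            ≈⟨ solve 3 (λ a b c → a :* b :+ b :* c := b :* (a :+ c)) ≈-refl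
                 [ strictlyMonotone? φ ] (p i ^ e G) (fromℕ (length (filter strictlyMonotone? φs))) ⟩
          p i ^ e G * ([ strictlyMonotone? φ ] + fromℕ (length (filter strictlyMonotone? φs)))
            ≈⟨ *-congˡ (fromℕ-length-filter strictlyMonotone? φ φs) ⟨
          p i ^ e G * fromℕ (length (filter strictlyMonotone? (φ ∷ φs))) ∎

  -- The list of colorings contains a given coloring only as the decoding of its code, which agrees
  -- with it pointwise; counts must be insensitive to the difference.
  N-cong : {χ χ′ : Coloring n k} → (∀ x y → χ x y ≡ χ′ x y) → ∀ i G → N χ i G ≡ N χ′ i G
  N-cong {n} {k} {χ} {χ′} χ≗χ′ i G = ≡.cong length
    (filter-≐ (isCopy? χ i G) (isCopy? χ′ i G) (respects (λ x y → ≡.sym (χ≗χ′ x y)) , respects χ≗χ′) (functions v n))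
    where
    open OrderedGraph G using (v)
    respects : {χ χ′ : Coloring n k} → (∀ x y → χ′ x y ≡ χ x y) →
      ∀ {φ : Fin v → Fin n} → IsCopy χ i G φ → IsCopy χ′ i G φ
    respects χ′≗χ {φ} copy x y x<y =
      proj₁ (copy x y x<y) , λ x~y → ≡.trans (χ′≗χ (φ x) (φ y)) (proj₂ (copy x y x<y) x~y)

  module _ {m} (wt : Fin (suc m) → Carrier) (𝒢 : Fin (suc m) → OrderedGraph) where

    M̄≤weightedCount : ∀ n (f : Fin (n ℕ.* n) → Fin (suc m)) →
      M̄ wt 𝒢 n ≤ weightedCount wt 𝒢 {n} (λ x y → f (combine x y))
    M̄≤weightedCount n f = ≤-respʳ-≈
      (sum-cong-≋ {suc m} λ i → *-congˡ {wt i} (≈-reflexive (≡.cong fromℕ (N-cong {n}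
        (λ x y → Fin.finToFun-funToFin f (combine x y)) i (𝒢 i)))))
      (All.lookup (min≤xs _ _) (∈-map⁺ (weightedCount wt 𝒢 {n}) (∈-map⁺ _ (∈-map⁺ finToFun (∈-allFin (funToFin f))))))
      where open Data.List.Extrema totalOrder using (min≤xs)

    -- The minimum is below every weighted count, hence below their average, so no good coloring has
    -- to be exhibited.
    M̄≤expected : (∀ i → 0# ≤ wt i) → ∀ n p → (∀ i → 0# ≤ p i) → sum p ≈ 1# →
      M̄ wt 𝒢 n ≤ sum (λ i → wt i * p i ^ e (𝒢 i) * fromℕ (n C OrderedGraph.v (𝒢 i)))
    M̄≤expected 0≤wt n p 0≤p Σp≈1 = begin
      M̄ wt 𝒢 n
        ≈⟨ 𝔼-const (n ℕ.* n) _ ⟨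
      𝔼 (n ℕ.* n) (λ _ → M̄ wt 𝒢 n)
        ≤⟨ 𝔼-mono-≤ (n ℕ.* n) (M̄≤weightedCount n) ⟩
      𝔼 (n ℕ.* n) (λ f → weightedCount wt 𝒢 {n} (decode f))
        ≈⟨ 𝔼-sum (n ℕ.* n) (λ i f → wt i * fromℕ (N {n} (decode f) i (𝒢 i))) ⟩
      sum (λ i → 𝔼 (n ℕ.* n) (λ f → wt i * fromℕ (N {n} (decode f) i (𝒢 i))))
        ≤⟨ sum-mono-≤ (λ i → ≤-respˡ-≈ (≈-sym (𝔼-* (n ℕ.* n) (wt i) _)) (≤-respʳ-≈ (≈-sym (*-assoc _ _ _))
             (*-monoˡ-≤ (0≤wt i) (𝔼-N i (𝒢 i) n)))) ⟩
      sum (λ i → wt i * p i ^ e (𝒢 i) * fromℕ (n C OrderedGraph.v (𝒢 i))) ∎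
      where open Expectation p 0≤p Σp≈1

-- Smallest graphs and positive binomial coefficients.

∃I* : ∀ {m} (𝒢 : Fin (suc m) → OrderedGraph) → ∃ (I* 𝒢)
∃I* {m} 𝒢 with ℕ-Extrema.argmin-sel id (OrderedGraph.v (𝒢 zero)) (map (λ i → OrderedGraph.v (𝒢 i)) (allFin (suc m)))
... | inj₁ h*≡ = zero , ≡.sym h*≡
... | inj₂ h*∈ with i , _ , h*≡ ← ∈-map⁻ (λ i → OrderedGraph.v (𝒢 i)) h*∈ = i , ≡.sym h*≡

-- The inclusion of `Fin k` into `Fin n` is strictly monotone, so the list counted by `n C k` is
-- nonempty.
0<nCk : ∀ {n k} → k ℕ.≤ n → 0 ℕ.< n C k
0<nCk {n} {k} k≤n with ψ , ψ∈ , _ ← ∈-strictlyMonotones k n {λ x → Fin.inject≤ x k≤n}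
  (λ x y x<y → ≡.subst₂ ℕ._<_ (≡.sym (Fin.toℕ-inject≤ x k≤n)) (≡.sym (Fin.toℕ-inject≤ y k≤n)) x<y) =
  ≡.subst (0 ℕ.<_) (length-strictlyMonotones k n) (nonempty ψ∈)
  where
  nonempty : ∀ {a} {A : Set a} {x : A} {xs} → x ∈ xs → 0 ℕ.< length xs
  nonempty {xs = _ ∷ _} _ = ℕ.z<s

-- The bound on the limit and its two closed forms.

module UpperBounds {c ℓ₁ ℓ₂} (R : CompleteOrderedField c ℓ₁ ℓ₂) where

  open OrderedField R
  open Continuity R
  open SimplexMinimum R
  open RandomColoring R
  open Multiplicity R
  open Algebra.Properties.Semiring.Exp semiring using (^-congˡ)
  open Algebra.Properties.CommutativeSemiring.Exp commutativeSemiring using (^-distrib-*)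
  open ≤-Reasoning

  sumOver-δ : ∀ {k s} {I : Pred (Fin k) s} (I? : Decidable I) (f : Fin k → Carrier) {j} → I j →
    sumOver I? (λ i → f i * [ i Fin.≟ j ]) ≈ f j
  sumOver-δ I? f {j} Ij = begin-equality
    sumOver I? (λ i → f i * [ i Fin.≟ j ])
      ≈⟨ sum-cong-≋ (λ i → term i (I? i)) ⟩
    sum (λ i → (if does (I? i) then f i else 0#) * [ i Fin.≟ j ])
      ≈⟨ sum-δ (λ i → if does (I? i) then f i else 0#) j ⟩
    (if does (I? j) then f j else 0#)
      ≈⟨ ≈-reflexive (if-yes (I? j) Ij) ⟩
    f j ∎
    where
    term : ∀ {a} {A : Set a} i (A? : Dec A) →
      (if does A? then f i * [ i Fin.≟ j ] else 0#) ≈ (if does A? then f i else 0#) * [ i Fin.≟ j ]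
    term i (yes _) = ≈-refl
    term i (no _)  = ≈-sym (zeroˡ _)

  ⁻¹-unique : ∀ {x y} → 0# < x → x * y ≈ 1# → y ≈ x ⁻¹
  ⁻¹-unique {x} {y} 0<x xy≈1 = begin-equality
    y                 ≈⟨ *-identityʳ y ⟨
    y * 1#            ≈⟨ *-congˡ (*-inverseʳ x (>⇒≉0 0<x)) ⟨
    y * (x * x ⁻¹)    ≈⟨ solve 3 (λ x y z → y :* (x :* z) := x :* y :* z) ≈-refl x y (x ⁻¹) ⟩
    x * y * x ⁻¹      ≈⟨ *-congʳ xy≈1 ⟩
    1# * x ⁻¹         ≈⟨ *-identityˡ _ ⟩
    x ⁻¹              ∎

  1^n≈1 : ∀ n → 1# ^ n ≈ 1#
  1^n≈1 zero    = ≈-refl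
  1^n≈1 (suc n) = ≈-trans (*-identityˡ _) (1^n≈1 n)

  ^-⁻¹ : ∀ {x} → 0# < x → ∀ n → (x ⁻¹) ^ n ≈ (x ^ n) ⁻¹
  ^-⁻¹ {x} 0<x n = ⁻¹-unique (^-pos n 0<x) (begin-equality
    x ^ n * (x ⁻¹) ^ n  ≈⟨ ^-distrib-* x (x ⁻¹) n ⟨
    (x * x ⁻¹) ^ n      ≈⟨ ^-congˡ n (*-inverseʳ x (>⇒≉0 0<x)) ⟩
    1# ^ n              ≈⟨ 1^n≈1 n ⟩
    1#                  ∎)

  root-pos : ∀ {d x r} → 1 ℕ.≤ d → 0# < x → IsRoot d x r → 0# < r
  root-pos {d} 1≤d 0<x (0≤r , r^d≈x) = 0≤r , λ 0≈r → >⇒≉0 0<x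
    (≈-trans (≈-sym r^d≈x) (≈-trans (^-congˡ d (≈-sym 0≈r)) (0^n≈0 1≤d)))

  module _ {m} (𝒢 : Fin (suc m) → OrderedGraph) (wt : Fin (suc m) → Carrier)
           (1≤e : ∀ i → 1 ℕ.≤ e (𝒢 i)) (0<wt : ∀ i → 0# < wt i) where

    open OrderedGraph using (v)

    I? : Decidable (I* 𝒢)
    I? = I*? 𝒢

    i₀ = proj₁ (∃I* 𝒢)
    i₀∈I* = proj₂ (∃I* 𝒢)

    expected : (Fin (suc m) → Carrier) → Carrier
    expected p = sumOver I? (λ i → wt i * p i ^ e (𝒢 i))

    -- Colors outside I* are not used, so the remaining graphs all have h*
    -- vertices and the bound on M̄ n is an exact multiple of n C h*.

    M̄≤expected* : ∀ {p} → Simplex I? p → ∀ n → M̄ wt 𝒢 n ≤ expected p * fromℕ (n C h* 𝒢)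
    M̄≤expected* {p} (0≤p , Σp≈1) n = begin
      M̄ wt 𝒢 n
        ≤⟨ M̄≤expected wt 𝒢 (<⇒≤ ∘ 0<wt) n p* (masked-nonNeg I? p 0≤p) Σp≈1 ⟩
      sum (λ i → wt i * p* i ^ e (𝒢 i) * fromℕ (n C v (𝒢 i)))
        ≈⟨ sum-cong-≋ {suc m} (λ i → term i (I? i)) ⟩
      sum (λ i → (if does (I? i) then wt i * p i ^ e (𝒢 i) else 0#) * fromℕ (n C h* 𝒢))
        ≈⟨ *-distribʳ-sum (fromℕ (n C h* 𝒢)) (λ i → if does (I? i) then wt i * p i ^ e (𝒢 i) else 0#) ⟨
      expected p * fromℕ (n C h* 𝒢) ∎
      where
      p* : Fin (suc m) → Carrier
      -- With this masking, `sum p*` is by definition `sumOver I? p`, so `Σp≈1` applies as it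
      -- stands.
      p* i = if does (I? i) then p i else 0#

      term : ∀ i (d : Dec (I* 𝒢 i)) →
        wt i * (if does d then p i else 0#) ^ e (𝒢 i) * fromℕ (n C v (𝒢 i)) ≈
        (if does d then wt i * p i ^ e (𝒢 i) else 0#) * fromℕ (n C h* 𝒢)
      term i (yes v≡h*) = *-congˡ (≈-reflexive (≡.cong (λ h → fromℕ (n C h)) v≡h*))
      -- The presence of an edge enters here: `0# ^ 0` would be `1#`.
      term i (no _)     = begin-equality
        wt i * 0# ^ e (𝒢 i) * fromℕ (n C v (𝒢 i))  ≈⟨ *-congʳ (*-congˡ (0^n≈0 (1≤e i))) ⟩
        wt i * 0# * fromℕ (n C v (𝒢 i))            ≈⟨ *-congʳ (zeroʳ (wt i)) ⟩
        0# * fromℕ (n C v (𝒢 i))                   ≈⟨ zeroˡ _ ⟩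
        0#                                         ≈⟨ zeroˡ _ ⟨
        0# * fromℕ (n C h* 𝒢)                      ∎

    -- Were `π` larger, their difference could serve as the tolerance in the limit; but the
    -- densities stay at or below `expected p`, hence never come closer to `π` than that difference.
    constant≤expected : ∀ {p π} → Simplex I? p → IsWeightedMultiplicityConstant wt 𝒢 π → π ≤ expected p
    constant≤expected {p} {π} p∈ lim = ≮⇒≥ λ V<π →
      let n₀ , close = lim (π - expected p) (x<y⇒0<y-x V<π)
          -- From `h* 𝒢` on the denominator is positive and can be cancelled.
          n          = n₀ ℕ.⊔ h* 𝒢
      in <⇒≱ (proj₁ (close n (ℕ.m≤m⊔n n₀ (h* 𝒢)))) (begin
        M̄ wt 𝒢 n * fromℕ (n C h* 𝒢) ⁻¹ - π  ≤⟨ +-monoˡ-≤ (- π) (density≤ n (ℕ.m≤n⊔m n₀ (h* 𝒢))) ⟩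
        expected p - π                       ≈⟨ solve 2 (λ a b → a :- b := :- (b :- a)) ≈-refl (expected p) π ⟩
        - (π - expected p)                   ∎)
      where
      density≤ : ∀ n → h* 𝒢 ℕ.≤ n → M̄ wt 𝒢 n * fromℕ (n C h* 𝒢) ⁻¹ ≤ expected p
      density≤ n h*≤n = begin
        M̄ wt 𝒢 n * K ⁻¹          ≤⟨ *-monoʳ-≤ (⁻¹-nonNeg 0<K) (M̄≤expected* p∈ n) ⟩
        expected p * K * K ⁻¹    ≈⟨ *-assoc _ _ _ ⟩
        expected p * (K * K ⁻¹)  ≈⟨ *-congˡ (*-inverseʳ K (>⇒≉0 0<K)) ⟩
        expected p * 1#          ≈⟨ *-identityʳ _ ⟩
        expected p               ∎
        where
        K = fromℕ (n C h* 𝒢)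
        0<K : 0# < K
        0<K = fromℕ-pos (0<nCk h*≤n)

    -- With exponents 1 the objective is an average of the weights in `I*`: it is never below the
    -- least of them, and at the vertex `j` of the simplex it equals `wt j`.
    linear-minimum : ∀ {ρ} → IsMinimum (Simplex I?) expected ρ → (∀ i → I* 𝒢 i → e (𝒢 i) ≡ 1) →
      IsMinimum (I* 𝒢) wt ρ
    linear-minimum {ρ} ((p , (0≤p , Σp≈1) , Vp≈ρ) , ρ-min) e≡1 =
      (i , i∈I* , antisym wtᵢ≤ρ (ρ≤wt i i∈I*)) , ρ≤wt
      where
      open Data.List.Extrema totalOrder using (argmin; argmin-all; f[argmin]≤f[xs])

      linear : ∀ q → expected q ≈ sumOver I? (λ i → wt i * q i)
      linear q = sumOver-cong I? λ i i∈I* → *-congˡ {wt i}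
        (≈-trans (≈-reflexive (≡.cong (q i ^_) (e≡1 i i∈I*))) (*-identityʳ (q i)))

      candidates : List (Fin (suc m))
      candidates = filter I? (allFin (suc m))

      i : Fin (suc m)
      -- The default `i₀` also lies in `I*`, so the selected index does in either case.
      i = argmin wt i₀ candidates

      i∈I* : I* 𝒢 i
      i∈I* = argmin-all wt i₀∈I* (all-filter I? (allFin (suc m)))

      wtᵢ≤ρ : wt i ≤ ρ
      wtᵢ≤ρ = begin
        wt i                                ≈⟨ *-identityʳ (wt i) ⟨
        wt i * 1#                           ≈⟨ *-congˡ Σp≈1 ⟨
        wt i * sumOver I? p                 ≈⟨ sumOver-*ˡ I? (wt i) p ⟨
        sumOver I? (λ j → wt i * p j)       ≤⟨ sumOver-mono-≤ I? (λ j j∈I* → *-monoʳ-≤ (0≤p j j∈I*)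
          (All.lookup (f[argmin]≤f[xs] {f = wt} i₀ candidates) (∈-filter⁺ I? (∈-allFin j) j∈I*))) ⟩
        sumOver I? (λ j → wt j * p j)       ≈⟨ linear p ⟨
        expected p                          ≈⟨ Vp≈ρ ⟩
        ρ                                   ∎

      ρ≤wt : ∀ j → I* 𝒢 j → ρ ≤ wt j
      ρ≤wt j j∈I* = begin
        ρ                                            ≤⟨ ρ-min (λ l → [ l Fin.≟ j ]) ((λ l _ → [ l Fin.≟ j ]-nonNeg) , δ-sum) ⟩
        expected (λ l → [ l Fin.≟ j ])               ≈⟨ linear (λ l → [ l Fin.≟ j ]) ⟩
        sumOver I? (λ l → wt l * [ l Fin.≟ j ])      ≈⟨ sumOver-δ I? wt j∈I* ⟩
        wt j                                         ∎
        where
        δ-sum : sumOver I? (λ l → [ l Fin.≟ j ]) ≈ 1#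
        δ-sum = ≈-trans (sumOver-cong I? (λ l _ → ≈-sym (*-identityˡ [ l Fin.≟ j ]))) (sumOver-δ I? (λ _ → 1#) j∈I*)

    -- By Lagrange multipliers, the optimal p i is proportional to wt i ^ (- 1 / d) = r i.

    module _ {d} (1≤d : 1 ℕ.≤ d) (r : Fin (suc m) → Carrier) (r-root : ∀ i → IsRoot d (wt i ⁻¹) (r i)) where

      Σr : Carrier
      Σr = sumOver I? r

      0<Σr : 0# < Σr
      0<Σr = <-≤-trans (root-pos {d} 1≤d (⁻¹-pos (0<wt i₀)) (r-root i₀))
        (term≤sumOver I? (λ i _ → proj₁ (r-root i)) i₀ i₀∈I*)

      normalized : Fin (suc m) → Carrier
      normalized i = Σr ⁻¹ * r i

      normalized∈ : Simplex I? normalized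
      normalized∈ = (λ i _ → *-nonNeg (⁻¹-nonNeg 0<Σr) (proj₁ (r-root i))) , (begin-equality
        sumOver I? normalized  ≈⟨ sumOver-*ˡ I? (Σr ⁻¹) r ⟩
        Σr ⁻¹ * Σr             ≈⟨ *-comm _ _ ⟩
        Σr * Σr ⁻¹             ≈⟨ *-inverseʳ Σr (>⇒≉0 0<Σr) ⟩
        1#                     ∎)

      -- As `r i ^ d` is the inverse of `wt i`, each weight cancels against `d` of the `d + 1`
      -- factors `r i`. The terms add up to `(Σr ⁻¹) ^ suc d * Σr`.
      expected-normalized : (∀ i → I* 𝒢 i → e (𝒢 i) ≡ suc d) → expected normalized ≈ (Σr ^ d) ⁻¹
      expected-normalized e≡ = begin-equality
        expected normalized
          ≈⟨ sumOver-cong I? term ⟩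
        sumOver I? (λ i → (Σr ⁻¹) ^ suc d * r i)
          ≈⟨ sumOver-*ˡ I? ((Σr ⁻¹) ^ suc d) r ⟩
        Σr ⁻¹ * (Σr ⁻¹) ^ d * Σr
          ≈⟨ solve 3 (λ s t u → s :* t :* u := u :* s :* t) ≈-refl (Σr ⁻¹) ((Σr ⁻¹) ^ d) Σr ⟩
        Σr * Σr ⁻¹ * (Σr ⁻¹) ^ d
          ≈⟨ *-congʳ (*-inverseʳ Σr (>⇒≉0 0<Σr)) ⟩
        1# * (Σr ⁻¹) ^ d
          ≈⟨ *-identityˡ _ ⟩
        (Σr ⁻¹) ^ d
          ≈⟨ ^-⁻¹ 0<Σr d ⟩
        (Σr ^ d) ⁻¹ ∎
        where
        term : ∀ i → I* 𝒢 i → wt i * normalized i ^ e (𝒢 i) ≈ (Σr ⁻¹) ^ suc d * r i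
        term i i∈I* = begin-equality
          wt i * normalized i ^ e (𝒢 i)
            ≈⟨ *-congˡ (≈-reflexive (≡.cong (normalized i ^_) (e≡ i i∈I*))) ⟩
          wt i * normalized i ^ suc d
            ≈⟨ *-congˡ (^-distrib-* (Σr ⁻¹) (r i) (suc d)) ⟩
          wt i * ((Σr ⁻¹) ^ suc d * (r i * r i ^ d))
            ≈⟨ *-congˡ (*-congˡ (*-congˡ (proj₂ (r-root i)))) ⟩
          wt i * ((Σr ⁻¹) ^ suc d * (r i * wt i ⁻¹))
            ≈⟨ solve 4 (λ w s r w′ → w :* (s :* (r :* w′)) := s :* r :* (w :* w′)) ≈-refl
                 (wt i) ((Σr ⁻¹) ^ suc d) (r i) (wt i ⁻¹) ⟩
          (Σr ⁻¹) ^ suc d * r i * (wt i * wt i ⁻¹)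
            ≈⟨ *-congˡ (*-inverseʳ (wt i) (>⇒≉0 (0<wt i))) ⟩
          (Σr ⁻¹) ^ suc d * r i * 1#
            ≈⟨ *-identityʳ _ ⟩
          (Σr ⁻¹) ^ suc d * r i ∎

theorem2p4 :
    ∀ {c ℓ₁ ℓ₂} (R : CompleteOrderedField c ℓ₁ ℓ₂) →
    let open CompleteOrderedField R
        open Multiplicity R
        open OrderedGraph using (v)
    in
    (m : ℕ) (𝒢 : Fin (suc m) → OrderedGraph) (wt : Fin (suc m) → Carrier) →
    (∀ i → 1 ℕ.≤ e (𝒢 i)) →
    (∀ i → 0# < wt i) →
    (∀ n → ∃ λ μ →
       IsMinimum (Simplex U?)
         (λ p → sum (λ i → wt i * p i ^ e (𝒢 i) * fromℕ (n C v (𝒢 i)))) μ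
       × M̄ wt 𝒢 n ≤ μ)
    × (∃ λ ρ →
         IsMinimum (Simplex (I*? 𝒢))
           (λ p → sumOver (I*? 𝒢) (λ i → wt i * p i ^ e (𝒢 i))) ρ
         × (∀ π → IsWeightedMultiplicityConstant wt 𝒢 π → π ≤ ρ)
         × ((∀ i → I* 𝒢 i → e (𝒢 i) ≡ 1) → IsMinimum (I* 𝒢) wt ρ))
    × (∀ e₀ → 1 ℕ.< e₀ → (∀ i → I* 𝒢 i → e (𝒢 i) ≡ e₀) →
       ∃ λ r →
         (∀ i → I* 𝒢 i → IsRoot (e₀ ∸ 1) (wt i ⁻¹) (r i))
         × (∀ π → IsWeightedMultiplicityConstant wt 𝒢 π →
              π ≤ (sumOver (I*? 𝒢) r ^ (e₀ ∸ 1)) ⁻¹))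
theorem2p4 R m 𝒢 wt 1≤e 0<wt = part₁ , part₂ , part₃
  where
  open OrderedField R
  open Continuity R
  open SimplexMinimum R
  open RandomColoring R
  open UpperBounds R
  open Multiplicity R
  open OrderedGraph using (v)

  weighted-increasing : ∀ i → Increasing 1# (λ x → wt i * x ^ e (𝒢 i))
  weighted-increasing i = *-increasing (<⇒≤ (0<wt i)) (^-increasing 0<1 (e (𝒢 i)))

  part₁ : ∀ n → ∃ λ μ →
    IsMinimum (Simplex U?) (λ p → sum (λ i → wt i * p i ^ e (𝒢 i) * fromℕ (n C v (𝒢 i)))) μ × M̄ wt 𝒢 n ≤ μ
  part₁ n =
    -- `sumOver U?` reduces to the plain `sum`, so the minimum over `Simplex U?` has the required
    -- form.
    let μ , (p , (0≤p , Σp≈1) , fp≈μ) , μ-min = simplex-minimum U?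
          {λ i x → wt i * x ^ e (𝒢 i) * fromℕ (n C v (𝒢 i))}
          (λ i → Increasing-resp (λ x → *-comm _ _)
            (*-increasing (fromℕ-nonNeg (n C v (𝒢 i))) (weighted-increasing i)))
          (zero , tt)
    in μ , ((p , (0≤p , Σp≈1) , fp≈μ) , μ-min) ,
       ≤-respʳ-≈ fp≈μ (M̄≤expected wt 𝒢 (<⇒≤ ∘ 0<wt) n p (λ i → 0≤p i tt) Σp≈1)

  part₂ : ∃ λ ρ → IsMinimum (Simplex (I*? 𝒢)) (expected 𝒢 wt 1≤e 0<wt) ρ
    × (∀ π → IsWeightedMultiplicityConstant wt 𝒢 π → π ≤ ρ)
    × ((∀ i → I* 𝒢 i → e (𝒢 i) ≡ 1) → IsMinimum (I* 𝒢) wt ρ)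
  part₂ =
    let ρ , ρ-min@((p , p∈ , fp≈ρ) , _) = simplex-minimum (I*? 𝒢)
          {λ i x → wt i * x ^ e (𝒢 i)} weighted-increasing (∃I* 𝒢)
    in ρ , ρ-min , (λ π lim → ≤-respʳ-≈ fp≈ρ (constant≤expected 𝒢 wt 1≤e 0<wt p∈ lim)) ,
       linear-minimum 𝒢 wt 1≤e 0<wt ρ-min

  part₃ : ∀ e₀ → 1 ℕ.< e₀ → (∀ i → I* 𝒢 i → e (𝒢 i) ≡ e₀) → ∃ λ r →
    (∀ i → I* 𝒢 i → IsRoot (e₀ ∸ 1) (wt i ⁻¹) (r i))
    × (∀ π → IsWeightedMultiplicityConstant wt 𝒢 π → π ≤ (sumOver (I*? 𝒢) r ^ (e₀ ∸ 1)) ⁻¹)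
  part₃ (suc d) (ℕ.s≤s 1≤d) e≡ =
    r , (λ i _ → r-root i) , λ π lim →
      ≤-respʳ-≈ (expected-normalized 𝒢 wt 1≤e 0<wt 1≤d r r-root e≡)
        (constant≤expected 𝒢 wt 1≤e 0<wt (normalized∈ 𝒢 wt 1≤e 0<wt 1≤d r r-root) lim)
    where
    roots : ∀ i → ∃ (IsRoot d (wt i ⁻¹))
    roots i = root 1≤d (⁻¹-nonNeg (0<wt i))

    r : Fin (suc m) → Carrier
    r i = proj₁ (roots i)

    r-root : ∀ i → IsRoot d (wt i ⁻¹) (r i)
    r-root i = proj₂ (roots i)
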